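{- Let $0\leq k\leq n$ and let $\mathsf{N}_1,\dots,\mathsf{N}_s$ be representatives of the isomorphism classes of cuspidal matroids of rank $k$ on $n$ elements. Then for every matroid $\mathsf{M}$ of rank $k$ on $n$ elements there exist unique integers $c_1,\dots,c_s$ such that $T_{\mathsf{M}}(x,y)=\sum_{i=1}^s c_i\,T_{\mathsf{N}_i}(x,y)$.
   Context: $T_{\mathsf{M}}(x,y)=\sum_{S\subseteq E}(x-1)^{\operatorname{rk}E-\operatorname{rk}S}(y-1)^{|S|-\operatorname{rk}S}$ is the Tutte polynomial. A matroid is elementary split if it has no minor isomorphic to $\mathsf{U}_{0,1}\oplus\mathsf{U}_{1,2}\oplus\mathsf{U}_{1,1}$ ($\mathsf{U}_{k,n}$ the uniform matroid); it is Schubert (nested) if its lattice of cyclic flats is a chain. A matroid is cuspidal if it is both Schubert and elementary split. Every cuspidal matroid of rank $k$ on $n$ elements is isomorphic to a matroid $\mathsf{\Lambda}_{r,k,h,n}$ on $[n]$ whose bases are the $k$-subsets $B\subseteq[n]$ with $|B\cap\{1,\dots,h\}|\geq r$, for some $0\leq r\leq h$ and $0< k-r\leq n-h$. -}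

module Defs where

open import Data.Nat as ℕ using (ℕ; zero; suc; _≤_; _<_; _∸_)
open import Data.Integer as ℤ using (ℤ; 0ℤ; 1ℤ)
open import Data.Bool using (Bool; true; false; _∧_; if_then_else_)
open import Data.Fin using (Fin; zero; suc; _≟_)
open import Data.Fin.Subset using (Subset; inside; outside; _∈_; _∉_; _⊆_; _∪_; _∩_; _-_; ⁅_⁆; ∣_∣; ⊤)
open import Data.Fin.Permutation using (Permutation′; _⟨$⟩ˡ_)
open import Data.Vec using (Vec; []; _∷_; lookup; tabulate)
open import Data.List using (List; []; _∷_; _++_; map; foldr; allFin)
open import Data.Bool.ListAction using (any)
open import Data.Product using (Σ; ∃; _×_; _,_)
open import Data.Sum using (_⊎_)
open import Function.Definitions using (Injective)
open import Relation.Binary.PropositionalEquality using (_≡_)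
open import Relation.Nullary using (¬_)
open import Relation.Nullary.Decidable using (⌊_⌋)

record Matroid (n : ℕ) : Set where
  field
    rk          : Subset n → ℕ
    rk-bounded  : ∀ X → rk X ≤ ∣ X ∣
    rk-mono     : ∀ {X Y} → X ⊆ Y → rk X ≤ rk Y
    rk-submod   : ∀ X Y → rk (X ∪ Y) ℕ.+ rk (X ∩ Y) ≤ rk X ℕ.+ rk Y

open Matroid public

rank : ∀ {n} → Matroid n → ℕ
rank M = rk M ⊤

permImage : ∀ {n} → Permutation′ n → Subset n → Subset n
permImage σ X = tabulate (λ i → lookup X (σ ⟨$⟩ˡ i))

_≅_ : ∀ {n} → Matroid n → Matroid n → Set
_≅_ {n} M N = Σ (Permutation′ n) λ σ → ∀ X → rk N (permImage σ X) ≡ rk M X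

mapImage : ∀ {m n} → (Fin m → Fin n) → Subset m → Subset n
mapImage {m} f X = tabulate (λ j → any (λ i → lookup X i ∧ ⌊ f i ≟ j ⌋) (allFin m))

-- M has a minor M / C \ D isomorphic to the matroid on Fin m with rank
-- function r: there are a set C (contracted) and an injection f : Fin m → [n]
-- avoiding C (D = complement of C ∪ image f is deleted) such that
-- r_{M/C\D}(f X) = rk(f X ∪ C) - rk C equals r X.
HasMinor : ∀ {n m} → Matroid n → (Subset m → ℕ) → Set
HasMinor {n} {m} M r =
  Σ (Subset n) λ C → Σ (Fin m → Fin n) λ f →
    Injective _≡_ _≡_ f × (∀ i → f i ∉ C) ×
    (∀ X → rk M (mapImage f X ∪ C) ∸ rk M C ≡ r X)

[_∈?_] : ∀ {n} → Fin n → Subset n → ℕ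
[ i ∈? X ] = if lookup X i then 1 else 0

-- rank function of U_{0,1} ⊕ U_{1,2} ⊕ U_{1,1} on Fin 4:
-- element 0 is a loop (U_{0,1}), elements 1,2 form U_{1,2}, element 3 is a
-- coloop (U_{1,1}).
rkU : Subset 4 → ℕ
rkU X = ℕ._⊓_ 1 ([ suc zero ∈? X ] ℕ.+ [ suc (suc zero) ∈? X ])
        ℕ.+ [ suc (suc (suc zero)) ∈? X ]

ElementarySplit : ∀ {n} → Matroid n → Set
ElementarySplit M = ¬ HasMinor M rkU

IsFlat : ∀ {n} → Matroid n → Subset n → Set
IsFlat M F = ∀ e → e ∉ F → rk M F < rk M (F ∪ ⁅ e ⁆)

IsCyclic : ∀ {n} → Matroid n → Subset n → Set
IsCyclic M F = ∀ e → e ∈ F → rk M (F - e) ≡ rk M F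

IsCyclicFlat : ∀ {n} → Matroid n → Subset n → Set
IsCyclicFlat M F = IsFlat M F × IsCyclic M F

Schubert : ∀ {n} → Matroid n → Set
Schubert M = ∀ F G → IsCyclicFlat M F → IsCyclicFlat M G → F ⊆ G ⊎ G ⊆ F

Cuspidal : ∀ {n} → Matroid n → Set
Cuspidal M = Schubert M × ElementarySplit M

-- Bivariate integer polynomials as coefficient functions:
-- p i j = coefficient of x^i y^j.

Poly : Set
Poly = ℕ → ℕ → ℤ

_≈P_ : Poly → Poly → Set
p ≈P q = ∀ i j → p i j ≡ q i j

0P : Poly
0P _ _ = 0ℤ

1P : Poly
1P zero zero = 1ℤ
1P _    _    = 0ℤ

_+P_ : Poly → Poly → Poly
(p +P q) i j = p i j ℤ.+ q i j

_·P_ : ℤ → Poly → Poly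
(c ·P p) i j = c ℤ.* p i j

mulX-1 : Poly → Poly
mulX-1 p zero    j = ℤ.- p zero j
mulX-1 p (suc i) j = p i j ℤ.- p (suc i) j

mulY-1 : Poly → Poly
mulY-1 p i zero    = ℤ.- p i zero
mulY-1 p i (suc j) = p i j ℤ.- p i (suc j)

iter : ℕ → (Poly → Poly) → Poly → Poly
iter zero    f p = p
iter (suc k) f p = f (iter k f p)

allSubsets : ∀ n → List (Subset n)
allSubsets zero    = [] ∷ []
allSubsets (suc n) = map (inside ∷_) (allSubsets n) ++ map (outside ∷_) (allSubsets n)

sumP : List Poly → Poly
sumP = foldr _+P_ 0P

tutte : ∀ {n} → Matroid n → Poly
tutte {n} M = sumP (map term (allSubsets n))
  where
  term : Subset n → Poly
  term S = iter (rank M ∸ rk M S) mulX-1 (iter (∣ S ∣ ∸ rk M S) mulY-1 1P)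

linComb : ∀ {s} → (Fin s → ℤ) → (Fin s → Poly) → Poly
linComb {s} c p = sumP (map (λ i → c i ·P p i) (allFin s))

{-# OPTIONS --safe #-}

-- Non-uniform cuspidal matroids of rank k on n elements are, up to isomorphism,
-- the matroids Λ(F, ρ) with rk X = min(k, |X \ F| + min(ρ, |X ∩ F|)): two cyclic
-- flats of positive nullity and non-full rank, one inside the other, produce the
-- forbidden minor, so there is only one of them, and it determines the rank of
-- every set.  Put a = k - ρ and b = |F| - ρ.
--
-- The corank u and nullity v of a set have u - v = k - |S|, so all matroids of rank
-- k have equally many sets on each diagonal of the (u, v)-plane.  Subtracting from
-- each point the boundary point of its diagonal leaves only 1 ≤ u ≤ k and
-- 1 ≤ v ≤ n - k.  In Λ(F, ρ) the set F sits at (a, b) and every other set lies on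
-- the boundary or strictly below (a, b); hence the system is unitriangular over ℤ.
-- The same triangularity, read off the coefficients of x^a y^b, gives uniqueness.

module Submission where

open import Defs
open import Data.Nat as ℕ using (ℕ; zero; suc; _≤_; _<_; _∸_; _+_; _⊓_; z≤n; s≤s)
import Data.Nat.Properties as ℕₚ
open import Data.Integer as ℤ using (ℤ; 0ℤ; 1ℤ)
import Data.Integer.Properties as ℤₚ
open import Data.Bool using (Bool; true; false; if_then_else_; not; _∧_)
open import Data.Bool.Properties using (T-≡; T-∧) renaming (_≟_ to _≟ᵇ_)
open import Data.Fin as Fin using (Fin; zero; suc)
import Data.Fin.Properties as Finₚ
open import Data.Fin.Permutation as Permutation using (Permutation′; _⟨$⟩ˡ_; _∘ₚ_; lift₀; flip)
open import Data.Fin.Subset using (Subset; inside; outside; _∈_; _∉_; _⊆_; _∪_; _∩_; _-_; ∁; ⁅_⁆; ∣_∣; ⊤; ⊥)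
open import Data.Fin.Subset.Properties
open import Data.Vec using ([]; _∷_; lookup; here; there)
open import Data.Vec.Properties using ([]=⇒lookup; lookup⇒[]=; lookup∘tabulate; tabulate∘lookup;
  tabulate-cong; lookup-zipWith; lookup-map; ≡-dec)
open import Data.List as List using (List; []; _∷_; map; allFin)
open import Data.List.Membership.Propositional using (lose; find) renaming (_∈_ to _∈ˡ_)
open import Data.List.Membership.Propositional.Properties using (∈-allFin; ∈-map⁺; ∈-map⁻; ∈-++⁺ˡ; ∈-++⁺ʳ)
open import Data.List.Membership.Propositional.Properties.WithK using (unique∧set⇒bag)
open import Data.List.Relation.Binary.BagAndSetEquality using (∼bag⇒↭)
open import Data.List.Relation.Binary.Permutation.Propositional as Perm using (_↭_)
open import Data.List.Relation.Unary.Any as Any using (here; there)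
open import Data.List.Relation.Unary.Any.Properties using (any⁺; any⁻)
import Data.List.Relation.Unary.All as All
open import Data.List.Relation.Unary.AllPairs as AllPairs using (_∷_)
open import Data.List.Relation.Unary.Unique.Propositional using (Unique)
open import Data.List.Relation.Unary.Unique.Propositional.Properties using (allFin⁺; map⁺; ++⁺)
open import Data.Product using (Σ; ∃; ∃₂; _×_; _,_; proj₁; proj₂)
open import Data.Sum using (_⊎_; inj₁; inj₂; [_,_]′)
open import Data.Empty using (⊥-elim)
open import Function using (_∘_; id; Equivalence; mk⇔)
open import Relation.Binary.PropositionalEquality using (_≡_; _≢_; refl; sym; trans; cong; cong₂; subst; module ≡-Reasoning)
open import Relation.Nullary using (¬_; yes; no; Dec)
open import Relation.Nullary.Decidable using (does; toWitness; fromWitness; ¬?; _×-dec_; decidable-stable)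
open import Relation.Unary using (Decidable)
open import Algebra.Properties.AbelianGroup ℤₚ.+-0-abelianGroup using (//-rightDividesˡ; //-rightDividesʳ)
import Algebra.Properties.CommutativeSemigroup ℤₚ.+-commutativeSemigroup as ℤ-semigroup
import Algebra.Properties.CommutativeSemigroup ℕₚ.+-commutativeSemigroup as ℕ-semigroup
open import Algebra.Properties.CommutativeMonoid.Sum ℕₚ.+-0-commutativeMonoid using (sum; sum-permute; sum-cong-≗)

-- Existence is settled before any polynomial is expanded. `E` pairs a matroid with an arbitrary
-- `φ : ℕ → ℕ → ℤ` in place of the monomials, so a linear relation becomes an identity between
-- counts of points (u, v); a Tutte coefficient is recovered when `φ u v` is the coefficient of x^i
-- y^j in (x - 1)^u (y - 1)^v. The boundary part left over by the diagonal subtraction is not an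
-- extra unknown: it is the pairing of U_{k,n} itself, where every set spans or is independent.
--
-- The representatives are given abstractly and their number is never computed. Existence therefore
-- needs that each Λ(F, ρ) is cuspidal, hence isomorphic to a representative; uniqueness needs the
-- converse, the classification, which gives every representative a leading exponent. Since (x -
-- 1)^u (y - 1)^v contributes to x^a y^b only if a ≤ u and b ≤ v, positive a and b discard all
-- boundary sets, and with them the whole of U_{k,n}, whose own leading term must be chosen
-- separately.

private
  variable
    n k ρ : ℕ
    A B C F X : Subset n
    e : Fin n

-- Integer combinations of polynomials

∑ : {A : Set} → (A → ℤ) → List A → ℤ
∑ f []       = 0ℤ
∑ f (x ∷ xs) = f x ℤ.+ ∑ f xs

module _ {A : Set} where

  ∑-cong : {f g : A → ℤ} → (∀ x → f x ≡ g x) → ∀ xs → ∑ f xs ≡ ∑ g xs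
  ∑-cong f≗g []       = refl
  ∑-cong f≗g (x ∷ xs) = cong₂ ℤ._+_ (f≗g x) (∑-cong f≗g xs)

  ∑-0 : ∀ (xs : List A) → ∑ (λ _ → 0ℤ) xs ≡ 0ℤ
  ∑-0 []       = refl
  ∑-0 (x ∷ xs) = trans (ℤₚ.+-identityˡ _) (∑-0 xs)

  ∑-zero : {f : A → ℤ} → (∀ x → f x ≡ 0ℤ) → ∀ xs → ∑ f xs ≡ 0ℤ
  ∑-zero f≗0 xs = trans (∑-cong f≗0 xs) (∑-0 xs)

  ∑-+ : ∀ (f g : A → ℤ) xs → ∑ (λ x → f x ℤ.+ g x) xs ≡ ∑ f xs ℤ.+ ∑ g xs
  ∑-+ f g []       = refl
  ∑-+ f g (x ∷ xs) = trans (cong (λ z → (f x ℤ.+ g x) ℤ.+ z) (∑-+ f g xs)) (ℤ-semigroup.interchange (f x) (g x) _ _)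

  ∑-* : ∀ c (f : A → ℤ) xs → ∑ (λ x → c ℤ.* f x) xs ≡ c ℤ.* ∑ f xs
  ∑-* c f []       = sym (ℤₚ.*-zeroʳ c)
  ∑-* c f (x ∷ xs) = trans (cong (λ z → c ℤ.* f x ℤ.+ z) (∑-* c f xs)) (sym (ℤₚ.*-distribˡ-+ c (f x) _))

  ∑-neg : ∀ (f : A → ℤ) xs → ∑ (λ x → ℤ.- f x) xs ≡ ℤ.- ∑ f xs
  ∑-neg f []       = refl
  ∑-neg f (x ∷ xs) = trans (cong (λ z → ℤ.- f x ℤ.+ z) (∑-neg f xs)) (sym (ℤₚ.neg-distrib-+ (f x) _))

  ∑-minus : ∀ (f g : A → ℤ) xs → ∑ (λ x → f x ℤ.- g x) xs ≡ ∑ f xs ℤ.- ∑ g xs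
  ∑-minus f g xs = trans (∑-+ f (λ x → ℤ.- g x) xs) (cong (λ z → ∑ f xs ℤ.+ z) (∑-neg g xs))

  ∑-↭ : ∀ (f : A → ℤ) {xs ys} → xs ↭ ys → ∑ f xs ≡ ∑ f ys
  ∑-↭ f Perm.refl              = refl
  ∑-↭ f (Perm.prep x p)        = cong (ℤ._+_ (f x)) (∑-↭ f p)
  ∑-↭ f (Perm.swap x y p)      = trans (cong (λ z → f x ℤ.+ (f y ℤ.+ z)) (∑-↭ f p)) (ℤ-semigroup.x∙yz≈y∙xz (f x) (f y) _)
  ∑-↭ f (Perm.trans p q)       = trans (∑-↭ f p) (∑-↭ f q)

  ∑-map : ∀ {B : Set} (f : B → ℤ) (h : A → B) xs → ∑ f (map h xs) ≡ ∑ (f ∘ h) xs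
  ∑-map f h []       = refl
  ∑-map f h (x ∷ xs) = cong (ℤ._+_ (f (h x))) (∑-map f h xs)

  private
    ∑-zero-on : ∀ {f : A → ℤ} {xs} → All.All (λ x → f x ≡ 0ℤ) xs → ∑ f xs ≡ 0ℤ
    ∑-zero-on All.[]         = refl
    ∑-zero-on (eq All.∷ eqs) = cong₂ ℤ._+_ eq (∑-zero-on eqs)

  ∑-single : ∀ {f : A → ℤ} {x xs} → Unique xs → x ∈ˡ xs →
             (∀ y → y ≢ x → f y ≡ 0ℤ) → ∑ f xs ≡ f x
  ∑-single {f} {x} (x∉xs ∷ uniq) (here refl) vanish =
    trans (cong (ℤ._+_ (f x)) (∑-zero-on (All.map (λ x≢y → vanish _ (x≢y ∘ sym)) x∉xs)))
          (ℤₚ.+-identityʳ (f x))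
  ∑-single {f} (y∉xs ∷ uniq) (there x∈xs) vanish =
    trans (cong₂ ℤ._+_ (vanish _ (λ { refl → All.lookup y∉xs x∈xs refl })) (∑-single uniq x∈xs vanish))
          (ℤₚ.+-identityˡ (f _))

sumP-∑ : ∀ {A : Set} (t : A → Poly) xs i j → sumP (map t xs) i j ≡ ∑ (λ x → t x i j) xs
sumP-∑ t []       i j = refl
sumP-∑ t (x ∷ xs) i j = cong (ℤ._+_ (t x i j)) (sumP-∑ t xs i j)

linComb-∑ : ∀ {s} (c : Fin s → ℤ) (p : Fin s → Poly) i j →
            linComb c p i j ≡ ∑ (λ l → c l ℤ.* p l i j) (allFin s)
linComb-∑ {s} c p = sumP-∑ (λ l → c l ·P p l) (allFin s)

-- Integer spans and triangular systems

module Span {Φ : Set} {s : ℕ} (E : Fin s → Φ → ℤ) where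

  -- The coefficients are chosen before `φ`, so one choice has to serve all test functions at once.
  InSpan : (Φ → ℤ) → Set
  InSpan f = Σ (Fin s → ℤ) λ c → ∀ φ → f φ ≡ ∑ (λ l → c l ℤ.* E l φ) (allFin s)

  span-cong : ∀ {f g} → (∀ φ → f φ ≡ g φ) → InSpan g → InSpan f
  span-cong f≗g (c , eq) = c , λ φ → trans (f≗g φ) (eq φ)

  span-0 : ∀ {f} → (∀ φ → f φ ≡ 0ℤ) → InSpan f
  span-0 f≗0 = (λ _ → 0ℤ) , λ φ →
    trans (f≗0 φ) (sym (∑-zero (λ l → ℤₚ.*-zeroˡ (E l φ)) (allFin s)))

  span-basis : ∀ i → InSpan (E i)
  span-basis i = c , λ φ → sym (trans (∑-single (allFin⁺ s) (∈-allFin i) (off φ)) (on φ))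
    where
    c : Fin s → ℤ
    c l = if does (l Fin.≟ i) then 1ℤ else 0ℤ
    off : ∀ φ l → l ≢ i → c l ℤ.* E l φ ≡ 0ℤ
    off φ l l≢i with l Fin.≟ i
    ... | yes l≡i = ⊥-elim (l≢i l≡i)
    ... | no  _   = ℤₚ.*-zeroˡ (E l φ)
    on : ∀ φ → c i ℤ.* E i φ ≡ E i φ
    on φ with i Fin.≟ i
    ... | yes _  = ℤₚ.*-identityˡ (E i φ)
    ... | no i≢i = ⊥-elim (i≢i refl)

  span-+ : ∀ {f g} → InSpan f → InSpan g → InSpan (λ φ → f φ ℤ.+ g φ)
  span-+ (c , f≗) (d , g≗) = (λ l → c l ℤ.+ d l) , λ φ →
    trans (cong₂ ℤ._+_ (f≗ φ) (g≗ φ))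
      (sym (trans (∑-cong (λ l → ℤₚ.*-distribʳ-+ (E l φ) (c l) (d l)) (allFin s))
                  (∑-+ (λ l → c l ℤ.* E l φ) (λ l → d l ℤ.* E l φ) (allFin s))))

  span-neg : ∀ {f} → InSpan f → InSpan (λ φ → ℤ.- f φ)
  span-neg (c , f≗) = (λ l → ℤ.- c l) , λ φ →
    trans (cong ℤ.-_ (f≗ φ))
      (sym (trans (∑-cong (λ l → sym (ℤₚ.neg-distribˡ-* (c l) (E l φ))) (allFin s))
                  (∑-neg (λ l → c l ℤ.* E l φ) (allFin s))))

  span-minus : ∀ {f g} → InSpan f → InSpan g → InSpan (λ φ → f φ ℤ.- g φ)
  span-minus p q = span-+ p (span-neg q)

  span-∑ : ∀ {A : Set} {f : A → Φ → ℤ} → (∀ x → InSpan (f x)) → ∀ xs → InSpan (λ φ → ∑ (λ x → f x φ) xs)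
  span-∑ p []       = span-0 (λ _ → refl)
  span-∑ p (x ∷ xs) = span-+ (p x) (span-∑ p xs)

linComb-minus : ∀ {s} (c d : Fin s → ℤ) (T : Fin s → Poly) → linComb c T ≈P linComb d T →
                linComb (λ l → c l ℤ.- d l) T ≈P 0P
linComb-minus {s} c d T eq i j = begin
  linComb (λ l → c l ℤ.- d l) T i j
    ≡⟨ linComb-∑ (λ l → c l ℤ.- d l) T i j ⟩
  ∑ (λ l → (c l ℤ.- d l) ℤ.* T l i j) (allFin s)
    ≡⟨ ∑-cong (λ l → trans (ℤₚ.*-distribʳ-+ (T l i j) (c l) (ℤ.- d l))
                           (cong (λ z → c l ℤ.* T l i j ℤ.+ z) (sym (ℤₚ.neg-distribˡ-* (d l) (T l i j))))) (allFin s) ⟩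
  ∑ (λ l → c l ℤ.* T l i j ℤ.- d l ℤ.* T l i j) (allFin s)
    ≡⟨ ∑-minus (λ l → c l ℤ.* T l i j) (λ l → d l ℤ.* T l i j) (allFin s) ⟩
  ∑ (λ l → c l ℤ.* T l i j) (allFin s) ℤ.- ∑ (λ l → d l ℤ.* T l i j) (allFin s)
    ≡⟨ ℤₚ.i≡j⇒i-j≡0 (trans (sym (linComb-∑ c T i j)) (trans (eq i j) (linComb-∑ d T i j))) ⟩
  0ℤ ∎
  where open ≡-Reasoning

module _ {s : ℕ} (T : Fin s → Poly) (w p q : Fin s → ℕ) (W : ℕ) (w<W : ∀ i → w i < W)
         (leading : ∀ i → T i (p i) (q i) ≡ 1ℤ)
         (lower   : ∀ i j → j ≢ i → w j ≤ w i → T j (p i) (q i) ≡ 0ℤ) where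

  -- Induction from the largest weight downwards. At the coefficient (`p i`, `q i`) the other
  -- members of weight at most `w i` vanish by `lower`, and the heavier ones already have
  -- coefficient zero. The fuel `m` bounds the distance from `w i` up to `W`.
  triangular⇒independent : ∀ d → linComb d T ≈P 0P → ∀ i → d i ≡ 0ℤ
  triangular⇒independent d eq i = go W i (ℕₚ.m≤n+m W (w i))
    where
    go : ∀ m i → W ≤ w i ℕ.+ m → d i ≡ 0ℤ
    go zero    i W≤ = ⊥-elim (ℕₚ.<⇒≱ (w<W i) (subst (W ≤_) (ℕₚ.+-identityʳ (w i)) W≤))
    go (suc m) i W≤ = begin
      d i                                            ≡⟨ ℤₚ.*-identityʳ (d i) ⟨
      d i ℤ.* 1ℤ                                     ≡⟨ cong (d i ℤ.*_) (leading i) ⟨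
      d i ℤ.* T i (p i) (q i)                        ≡⟨ ∑-single (allFin⁺ s) (∈-allFin i) off ⟨
      ∑ (λ l → d l ℤ.* T l (p i) (q i)) (allFin s)   ≡⟨ linComb-∑ d T (p i) (q i) ⟨
      linComb d T (p i) (q i)                        ≡⟨ eq (p i) (q i) ⟩
      0ℤ ∎
      where
      open ≡-Reasoning
      off : ∀ l → l ≢ i → d l ℤ.* T l (p i) (q i) ≡ 0ℤ
      off l l≢i with ℕₚ.≤-<-connex (w l) (w i)
      ... | inj₁ wl≤wi = trans (cong (d l ℤ.*_) (lower i l l≢i wl≤wi)) (ℤₚ.*-zeroʳ (d l))
      ... | inj₂ wi<wl = trans (cong (ℤ._* T l (p i) (q i)) (go m l
                           (ℕₚ.≤-trans W≤ (subst (ℕ._≤ w l ℕ.+ m) (sym (ℕₚ.+-suc (w i) m)) (ℕₚ.+-monoˡ-≤ m wi<wl)))))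
                           (ℤₚ.*-zeroˡ (T l (p i) (q i)))

-- Coefficients of (x - 1)^u (y - 1)^v

mono : ℕ → ℕ → Poly
mono u v = iter u mulX-1 (iter v mulY-1 1P)

private
  iterY-x : ∀ v i j → iter v mulY-1 1P (suc i) j ≡ 0ℤ
  iterY-x zero    i j       = refl
  iterY-x (suc v) i zero    = cong ℤ.-_ (iterY-x v i zero)
  iterY-x (suc v) i (suc j) = cong₂ ℤ._-_ (iterY-x v i j) (iterY-x v i (suc j))

  iterY-high : ∀ v i {j} → v < j → iter v mulY-1 1P i j ≡ 0ℤ
  iterY-high zero    zero    {suc j} _         = refl
  iterY-high zero    (suc i) {suc j} _         = refl
  iterY-high (suc v) i       {suc j} (s≤s v<j) =
    cong₂ ℤ._-_ (iterY-high v i v<j) (iterY-high v i (ℕₚ.m<n⇒m<1+n v<j))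

  iterY-lead : ∀ v → iter v mulY-1 1P 0 v ≡ 1ℤ
  iterY-lead zero    = refl
  iterY-lead (suc v) = cong₂ ℤ._-_ (iterY-lead v) (iterY-high v 0 (ℕₚ.n<1+n v))

  module _ (r : Poly) (r-x : ∀ i j → r (suc i) j ≡ 0ℤ) where

    iterX-high : ∀ u {i} j → u < i → iter u mulX-1 r i j ≡ 0ℤ
    iterX-high zero    {suc i} j _         = r-x i j
    iterX-high (suc u) {suc i} j (s≤s u<i) =
      cong₂ ℤ._-_ (iterX-high u j u<i) (iterX-high u j (ℕₚ.m<n⇒m<1+n u<i))

    iterX-lead : ∀ u j → iter u mulX-1 r u j ≡ r 0 j
    iterX-lead zero    j = refl
    iterX-lead (suc u) j = trans (cong₂ ℤ._-_ (iterX-lead u j) (iterX-high u j (ℕₚ.n<1+n u))) (ℤₚ.+-identityʳ _)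

  iterX-col : ∀ u (r : Poly) j → (∀ i → r i j ≡ 0ℤ) → ∀ i → iter u mulX-1 r i j ≡ 0ℤ
  iterX-col zero    r j r≡0 i       = r≡0 i
  iterX-col (suc u) r j r≡0 zero    = cong ℤ.-_ (iterX-col u r j r≡0 zero)
  iterX-col (suc u) r j r≡0 (suc i) = cong₂ ℤ._-_ (iterX-col u r j r≡0 i) (iterX-col u r j r≡0 (suc i))

mono-x-high : ∀ {u i} v j → u < i → mono u v i j ≡ 0ℤ
mono-x-high v j = iterX-high (iter v mulY-1 1P) (iterY-x v) _ j

mono-y-high : ∀ u {v} i {j} → v < j → mono u v i j ≡ 0ℤ
mono-y-high u {v} i {j} v<j = iterX-col u (iter v mulY-1 1P) j (λ i → iterY-high v i v<j) i

mono-lead : ∀ u v → mono u v u v ≡ 1ℤ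
mono-lead u v = trans (iterX-lead (iter v mulY-1 1P) (iterY-x v) u v) (iterY-lead v)

-- Closure and minors

∪-lub : A ⊆ C → B ⊆ C → A ∪ B ⊆ C
∪-lub A⊆C B⊆C x∈ = [ A⊆C , B⊆C ]′ (x∈p∪q⁻ _ _ x∈)

⁅⁆⊆ : e ∈ A → ⁅ e ⁆ ⊆ A
⁅⁆⊆ {e = e} {A = A} e∈A x∈ = subst (_∈ A) (sym (x∈⁅y⁆⇒x≡y e x∈)) e∈A

⊆∪ˡ : A ⊆ A ∪ B
⊆∪ˡ {B = B} = p⊆p∪q B

e∈∪⁅e⁆ : e ∈ A ∪ ⁅ e ⁆
e∈∪⁅e⁆ {e = e} = x∈p∪q⁺ (inj₂ (x∈⁅x⁆ e))

∪-mono : ∀ {D : Subset n} → A ⊆ C → B ⊆ D → A ∪ B ⊆ C ∪ D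
∪-mono A⊆C B⊆D = ∪-lub (x∈p∪q⁺ ∘ inj₁ ∘ A⊆C) (x∈p∪q⁺ ∘ inj₂ ∘ B⊆D)

∩-glb : C ⊆ A → C ⊆ B → C ⊆ A ∩ B
∩-glb C⊆A C⊆B x∈ = x∈p∩q⁺ (C⊆A x∈ , C⊆B x∈)

-⊆ : A - e ⊆ A
-⊆ {A = A} {e = e} = p─q⊆p A ⁅ e ⁆

x∉p-x : ∀ (A : Subset n) e → e ∉ A - e
x∉p-x (b ∷ A) zero    ()
x∉p-x (b ∷ A) (suc e) (there e∈) = x∉p-x A e e∈

nonmember : ∀ {n} (A : Subset n) → ∣ A ∣ < n → ∃ λ e → e ∉ A
nonmember (outside ∷ A) _        = zero , λ ()
nonmember (inside ∷ A)  (s≤s A<) with e , e∉ ← nonmember A A< = suc e , λ { (there e∈) → e∉ e∈ }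

member : ∀ {n} (A : Subset n) → 0 < ∣ A ∣ → ∃ λ e → e ∈ A
member {n} A 0<A with nonempty? A
... | yes ne = ne
... | no ¬ne = ⊥-elim (ℕₚ.<⇒≢ 0<A (sym (trans (cong ∣_∣ (Empty-unique ¬ne)) (∣⊥∣≡0 n))))

∣∣≡0⇒⊆ : ∣ A ∣ ≡ 0 → A ⊆ B
∣∣≡0⇒⊆ {A = A} A≡0 {x} x∈ =
  ⊥-elim (ℕₚ.<⇒≱ (subst (_≤ ∣ A ∣) (∣⁅x⁆∣≡1 x) (p⊆q⇒∣p∣≤∣q∣ (⁅⁆⊆ x∈))) (ℕₚ.≤-reflexive A≡0))

∣∩∣+∣∩∁∣ : ∀ (X F : Subset n) → ∣ X ∩ F ∣ + ∣ X ∩ ∁ F ∣ ≡ ∣ X ∣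
∣∩∣+∣∩∁∣ []            []            = refl
∣∩∣+∣∩∁∣ (outside ∷ X) (b ∷ F)       = ∣∩∣+∣∩∁∣ X F
∣∩∣+∣∩∁∣ (inside ∷ X)  (inside ∷ F)  = cong suc (∣∩∣+∣∩∁∣ X F)
∣∩∣+∣∩∁∣ (inside ∷ X)  (outside ∷ F) = trans (ℕₚ.+-suc _ _) (cong suc (∣∩∣+∣∩∁∣ X F))

∣∪∣+∣∩∣ : ∀ (X Y : Subset n) → ∣ X ∪ Y ∣ + ∣ X ∩ Y ∣ ≡ ∣ X ∣ + ∣ Y ∣
∣∪∣+∣∩∣ []            []            = refl
∣∪∣+∣∩∣ (outside ∷ X) (outside ∷ Y) = ∣∪∣+∣∩∣ X Y
∣∪∣+∣∩∣ (outside ∷ X) (inside ∷ Y)  = trans (cong suc (∣∪∣+∣∩∣ X Y)) (sym (ℕₚ.+-suc _ _))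
∣∪∣+∣∩∣ (inside ∷ X)  (outside ∷ Y) = cong suc (∣∪∣+∣∩∣ X Y)
∣∪∣+∣∩∣ (inside ∷ X)  (inside ∷ Y)  =
  cong suc (trans (ℕₚ.+-suc _ _) (trans (cong suc (∣∪∣+∣∩∣ X Y)) (sym (ℕₚ.+-suc _ _))))

module _ {m n} (f : Fin m → Fin n) where

  ∈-mapImage⁺ : ∀ {X i} → i ∈ X → f i ∈ mapImage f X
  ∈-mapImage⁺ {X} {i} i∈X = lookup⇒[]= (f i) _ (trans (lookup∘tabulate _ (f i))
    (Equivalence.to T-≡ (any⁺ _ (lose (∈-allFin i)
      (Equivalence.from T-∧ (Equivalence.from T-≡ ([]=⇒lookup i∈X) , fromWitness refl))))))

  ∈-mapImage⁻ : ∀ {X j} → j ∈ mapImage f X → ∃ λ i → i ∈ X × f i ≡ j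
  ∈-mapImage⁻ {X} {j} j∈
    with i , _ , t ← find (any⁻ _ (allFin m) (Equivalence.from T-≡ (trans (sym (lookup∘tabulate _ j)) ([]=⇒lookup j∈))))
    with ti , tj ← Equivalence.to T-∧ t
    = i , lookup⇒[]= i X (Equivalence.to T-≡ ti) , toWitness tj

-- Greedy growth, with `d` bounding the room left. As `P` need not be monotone, maximality is
-- claimed only against one-element extensions, which is what closures and the set `H` of
-- `two-cyclic-flats⇒minor` require.
∃-maximal : ∀ {P : Subset n → Set} → Decidable P → P A →
            ∃ λ B → A ⊆ B × P B × (∀ e → e ∉ B → ¬ P (B ∪ ⁅ e ⁆))
∃-maximal {n} {A} {P} P? PA = go n A (ℕₚ.m≤n+m n ∣ A ∣) PA
  where
  go : ∀ d A → n ≤ ∣ A ∣ + d → P A → ∃ λ B → A ⊆ B × P B × (∀ e → e ∉ B → ¬ P (B ∪ ⁅ e ⁆))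
  go d A n≤ PA with Finₚ.any? (λ e → ¬? (e ∈? A) ×-dec P? (A ∪ ⁅ e ⁆))
  ... | no none = A , id , PA , λ e e∉A Pe → none (e , e∉A , Pe)
  ... | yes (e , e∉A , Pe) with A<A∪e ← p⊂q⇒∣p∣<∣q∣ {p = A} {q = A ∪ ⁅ e ⁆} (⊆∪ˡ , e , e∈∪⁅e⁆ , e∉A) with d
  ...   | zero  = ⊥-elim (ℕₚ.<⇒≱ (ℕₚ.<-≤-trans A<A∪e (∣p∣≤n (A ∪ ⁅ e ⁆))) (subst (n ≤_) (ℕₚ.+-identityʳ _) n≤))
  ...   | suc d′ with B , A∪e⊆B , PB , max ← go d′ (A ∪ ⁅ e ⁆)
                      (ℕₚ.≤-trans n≤ (subst (_≤ ∣ A ∪ ⁅ e ⁆ ∣ + d′) (sym (ℕₚ.+-suc _ d′)) (ℕₚ.+-monoˡ-≤ d′ A<A∪e))) Pe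
        = B , A∪e⊆B ∘ ⊆∪ˡ , PB , max

module MatroidProperties {n} (M : Matroid n) where

  private
    r = rk M

  -- Submodularity for `B` and `A ∪ ⁅ e ⁆`, whose intersection contains `A`. The additive form
  -- avoids truncated subtraction.
  diminishing : A ⊆ B → r (B ∪ ⁅ e ⁆) + r A ≤ r B + r (A ∪ ⁅ e ⁆)
  diminishing {A} {B} {e} A⊆B = ℕₚ.≤-trans
    (ℕₚ.+-mono-≤ (rk-mono M (∪-mono {A = B} {C = B} {B = ⁅ e ⁆} id (x∈p∪q⁺ ∘ inj₂)))
                 (rk-mono M (∩-glb {C = A} {A = B} {B = A ∪ ⁅ e ⁆} A⊆B ⊆∪ˡ)))
    (rk-submod M B (A ∪ ⁅ e ⁆))

  rk-unit : r (A ∪ ⁅ e ⁆) ≤ suc (r A)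
  rk-unit {A} {e} = begin
    r (A ∪ ⁅ e ⁆)                   ≤⟨ ℕₚ.m≤m+n _ _ ⟩
    r (A ∪ ⁅ e ⁆) + r (A ∩ ⁅ e ⁆)   ≤⟨ rk-submod M A ⁅ e ⁆ ⟩
    r A + r ⁅ e ⁆                   ≤⟨ ℕₚ.+-monoʳ-≤ (r A) (ℕₚ.≤-trans (rk-bounded M ⁅ e ⁆) (ℕₚ.≤-reflexive (∣⁅x⁆∣≡1 e))) ⟩
    r A + 1                         ≡⟨ ℕₚ.+-comm (r A) 1 ⟩
    suc (r A)                       ∎
    where open ℕₚ.≤-Reasoning

  closure : ∀ A → ∃ λ F → A ⊆ F × r F ≡ r A × IsFlat M F
  closure A with F , A⊆F , rF , max ← ∃-maximal {A = A} {P = λ F → r F ≡ r A} (λ F → r F ℕₚ.≟ r A) refl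
    = F , A⊆F , rF , λ e e∉F → ℕₚ.≤∧≢⇒< (rk-mono M ⊆∪ˡ) (λ eq → max e e∉F (trans (sym eq) rF))

  rk-spanned : (∀ {e} → e ∈ B → r (A ∪ ⁅ e ⁆) ≤ r A) → r B ≤ r A
  rk-spanned {B} {A} spanned with F , A⊆F , rF , flat ← closure A = subst (r B ≤_) rF (rk-mono M B⊆F)
    where
    B⊆F : B ⊆ F
    B⊆F {e} e∈B = decidable-stable (e ∈? F) λ e∉F →
      ℕₚ.<⇒≱ (flat e e∉F) (ℕₚ.+-cancelʳ-≤ (r A) _ _
        (ℕₚ.≤-trans (diminishing A⊆F) (ℕₚ.+-monoʳ-≤ (r F) (spanned e∈B))))

  -- `e` is spanned by `A - e`, hence by the larger set `B - e`; formally, submodularity for `B - e`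
  -- and `A`.
  cyclic-⊆ : IsCyclic M A → A ⊆ B → e ∈ A → r (B - e) ≡ r B
  cyclic-⊆ {A} {B} {e} cyc A⊆B e∈A = ℕₚ.≤-antisym (rk-mono M -⊆)
    (ℕₚ.+-cancelʳ-≤ (r A) _ _ (begin
      r B + r A                                ≡⟨ cong (r B +_) (cyc e e∈A) ⟨
      r B + r (A - e)                          ≤⟨ ℕₚ.+-mono-≤ (rk-mono M B⊆) (rk-mono M (∩-glb {B = A} A-e⊆B-e -⊆)) ⟩
      r ((B - e) ∪ A) + r ((B - e) ∩ A)        ≤⟨ rk-submod M (B - e) A ⟩
      r (B - e) + r A                          ∎))
    where
    open ℕₚ.≤-Reasoning
    B⊆ : B ⊆ (B - e) ∪ A
    B⊆ {x} x∈B with x Fin.≟ e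
    ... | yes refl = x∈p∪q⁺ (inj₂ e∈A)
    ... | no x≢e   = x∈p∪q⁺ (inj₁ (x∈p∧x≢y⇒x∈p-y x∈B x≢e))
    A-e⊆B-e : A - e ⊆ B - e
    A-e⊆B-e {x} x∈ = x∈p∧x≢y⇒x∈p-y (A⊆B (-⊆ x∈)) (λ { refl → x∉p-x A e x∈ })

  -- After contracting `C`, the element `e` is a loop because `H` contains it and has no more rank
  -- than `C`; `x` and `y` are parallel because each raises the rank while `G`, containing both,
  -- exceeds `C` by at most one; `g` is a coloop because it lies off the flat `G`.
  module _ {C H G : Subset n} {e x y g : Fin n} (R : ℕ)
           (C⊆H : C ⊆ H) (H⊆G : H ⊆ G) (e∈H : e ∈ H) (e∉C : e ∉ C)
           (x∈G : x ∈ G) (y∈G : y ∈ G) (x∉H : x ∉ H) (y∉H : y ∉ H) (y≢x : y ≢ x) (g∉G : g ∉ G)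
           (rC : r C ≡ R) (rH : r H ≤ R) (rG : r G ≤ suc R)
           (rx : suc R ≤ r (C ∪ ⁅ x ⁆)) (ry : suc R ≤ r (C ∪ ⁅ y ⁆))
           (flat : IsFlat M G) where

    private
      f : Fin 4 → Fin n
      f = lookup (e ∷ x ∷ y ∷ g ∷ [])

      C⊆G : C ⊆ G
      C⊆G = H⊆G ∘ C⊆H

      f-inj : ∀ {i j} → f i ≡ f j → i ≡ j
      f-inj {zero} {zero} _ = refl
      f-inj {zero} {suc zero} refl = ⊥-elim (x∉H e∈H)
      f-inj {zero} {suc (suc zero)} refl = ⊥-elim (y∉H e∈H)
      f-inj {zero} {suc (suc (suc zero))} refl = ⊥-elim (g∉G (H⊆G e∈H))
      f-inj {suc zero} {zero} refl = ⊥-elim (x∉H e∈H)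
      f-inj {suc zero} {suc zero} _ = refl
      f-inj {suc zero} {suc (suc zero)} refl = ⊥-elim (y≢x refl)
      f-inj {suc zero} {suc (suc (suc zero))} refl = ⊥-elim (g∉G x∈G)
      f-inj {suc (suc zero)} {zero} refl = ⊥-elim (y∉H e∈H)
      f-inj {suc (suc zero)} {suc zero} refl = ⊥-elim (y≢x refl)
      f-inj {suc (suc zero)} {suc (suc zero)} _ = refl
      f-inj {suc (suc zero)} {suc (suc (suc zero))} refl = ⊥-elim (g∉G y∈G)
      f-inj {suc (suc (suc zero))} {zero} refl = ⊥-elim (g∉G (H⊆G e∈H))
      f-inj {suc (suc (suc zero))} {suc zero} refl = ⊥-elim (g∉G x∈G)
      f-inj {suc (suc (suc zero))} {suc (suc zero)} refl = ⊥-elim (g∉G y∈G)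
      f-inj {suc (suc (suc zero))} {suc (suc (suc zero))} _ = refl

      f∉C : ∀ i → f i ∉ C
      f∉C zero                   = e∉C
      f∉C (suc zero)             = x∉H ∘ C⊆H
      f∉C (suc (suc zero))       = y∉H ∘ C⊆H
      f∉C (suc (suc (suc zero))) = g∉G ∘ C⊆G

      module _ (X : Subset 4) where

        Im = mapImage f X ∪ C

        sandwich : ∀ {t} lo hi → t + R ≤ r lo → lo ⊆ Im → r hi ≤ t + R →
                   C ⊆ hi → (∀ i → i ∈ X → f i ∈ hi) → r Im ∸ r C ≡ t
        sandwich {t} lo hi ≤lo lo⊆ hi≤ C⊆hi X⊆hi = trans (cong (r Im ∸_) rC) (ℕₚ.≤-antisym
          (ℕₚ.≤-trans (ℕₚ.∸-monoˡ-≤ R (ℕₚ.≤-trans (rk-mono M (∪-lub im⊆ C⊆hi)) hi≤)) (ℕₚ.≤-reflexive (ℕₚ.m+n∸n≡m t R)))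
          (ℕₚ.≤-trans (ℕₚ.≤-reflexive (sym (ℕₚ.m+n∸n≡m t R))) (ℕₚ.∸-monoˡ-≤ R (ℕₚ.≤-trans ≤lo (rk-mono M lo⊆)))))
          where
          im⊆ : mapImage f X ⊆ hi
          im⊆ j∈ with i , i∈X , refl ← ∈-mapImage⁻ f j∈ = X⊆hi i i∈X

        C⊆Im : C ⊆ Im
        C⊆Im = x∈p∪q⁺ ∘ inj₂

        +⊆Im : ∀ {A} i → A ⊆ Im → i ∈ X → A ∪ ⁅ f i ⁆ ⊆ Im
        +⊆Im i A⊆ i∈X = ∪-lub A⊆ (⁅⁆⊆ (x∈p∪q⁺ (inj₁ (∈-mapImage⁺ f i∈X))))

      -- `g` raises the rank of the flat `G`, hence by `diminishing` that of each of its subsets.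
      +g : ∀ {t A} → A ⊆ G → t + R ≤ r A → suc t + R ≤ r (A ∪ ⁅ g ⁆)
      +g {t} {A} A⊆G t≤ = ℕₚ.≤-trans (s≤s t≤) (ℕₚ.+-cancelˡ-< (r G) _ _
        (ℕₚ.<-≤-trans (ℕₚ.+-monoˡ-< (r A) (flat g g∉G)) (diminishing A⊆G)))

      rC≥ : R ≤ r C
      rC≥ = ℕₚ.≤-reflexive (sym rC)

      g≤ : ∀ {t A} → r A ≤ t + R → r (A ∪ ⁅ g ⁆) ≤ suc t + R
      g≤ rA = ℕₚ.≤-trans rk-unit (s≤s rA)

      -- The entry of `e` never matters, nor that of `y` once `x` is present, which leaves six
      -- patterns. The lower set adds to `C` just the elements that count; the upper set is `H` or
      -- `G`, with `g` adjoined if it is present.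
      rank-eq : ∀ X → r (mapImage f X ∪ C) ∸ r C ≡ rkU X
      rank-eq X@(_ ∷ true ∷ _ ∷ true ∷ []) =
        sandwich X ((C ∪ ⁅ x ⁆) ∪ ⁅ g ⁆) (G ∪ ⁅ g ⁆) (+g (∪-lub C⊆G (⁅⁆⊆ x∈G)) rx)
          (+⊆Im X (suc (suc (suc zero))) (+⊆Im X (suc zero) (C⊆Im X) (there here)) (there (there (there here))))
          (g≤ {1} rG) (⊆∪ˡ ∘ C⊆G)
          (λ { zero _ → ⊆∪ˡ (H⊆G e∈H) ; (suc zero) _ → ⊆∪ˡ x∈G ; (suc (suc zero)) _ → ⊆∪ˡ y∈G ; (suc (suc (suc zero))) _ → e∈∪⁅e⁆ })
      rank-eq X@(_ ∷ true ∷ _ ∷ false ∷ []) =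
        sandwich X (C ∪ ⁅ x ⁆) G rx (+⊆Im X (suc zero) (C⊆Im X) (there here)) rG C⊆G
          (λ { zero _ → H⊆G e∈H ; (suc zero) _ → x∈G ; (suc (suc zero)) _ → y∈G ; (suc (suc (suc zero))) (there (there (there ()))) })
      rank-eq X@(_ ∷ false ∷ true ∷ true ∷ []) =
        sandwich X ((C ∪ ⁅ y ⁆) ∪ ⁅ g ⁆) (G ∪ ⁅ g ⁆) (+g (∪-lub C⊆G (⁅⁆⊆ y∈G)) ry)
          (+⊆Im X (suc (suc (suc zero))) (+⊆Im X (suc (suc zero)) (C⊆Im X) (there (there here))) (there (there (there here))))
          (g≤ {1} rG) (⊆∪ˡ ∘ C⊆G)
          (λ { zero _ → ⊆∪ˡ (H⊆G e∈H) ; (suc zero) _ → ⊆∪ˡ x∈G ; (suc (suc zero)) _ → ⊆∪ˡ y∈G ; (suc (suc (suc zero))) _ → e∈∪⁅e⁆ })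
      rank-eq X@(_ ∷ false ∷ true ∷ false ∷ []) =
        sandwich X (C ∪ ⁅ y ⁆) G ry (+⊆Im X (suc (suc zero)) (C⊆Im X) (there (there here))) rG C⊆G
          (λ { zero _ → H⊆G e∈H ; (suc zero) _ → x∈G ; (suc (suc zero)) _ → y∈G ; (suc (suc (suc zero))) (there (there (there ()))) })
      rank-eq X@(_ ∷ false ∷ false ∷ true ∷ []) =
        sandwich X (C ∪ ⁅ g ⁆) (H ∪ ⁅ g ⁆) (+g {0} C⊆G rC≥)
          (+⊆Im X (suc (suc (suc zero))) (C⊆Im X) (there (there (there here)))) (g≤ {0} rH) (⊆∪ˡ ∘ C⊆H)
          (λ { zero _ → ⊆∪ˡ e∈H ; (suc zero) (there ()) ; (suc (suc zero)) (there (there ())) ; (suc (suc (suc zero))) _ → e∈∪⁅e⁆ })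
      rank-eq X@(_ ∷ false ∷ false ∷ false ∷ []) =
        sandwich X C H rC≥ (C⊆Im X) rH C⊆H
          (λ { zero _ → e∈H ; (suc zero) (there ()) ; (suc (suc zero)) (there (there ())) ; (suc (suc (suc zero))) (there (there (there ()))) })

    loop-parallel-coloop : HasMinor M rkU
    loop-parallel-coloop = C , f , f-inj , f∉C , rank-eq

  -- `H` is grown from `F` inside `G` as long as it does not span `x`, so it ends up as a hyperplane
  -- of the restriction to `G`. Cyclicity of `F` supplies the loop, cyclicity of `G` a second
  -- element parallel to `x`, and the deficient rank of `G` the coloop.
  two-cyclic-flats⇒minor : ∀ {F G x} → IsCyclicFlat M F → IsCyclicFlat M G → F ⊆ G →
                           x ∈ G → x ∉ F → 0 < ∣ F ∣ → r G < rank M → HasMinor M rkU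
  two-cyclic-flats⇒minor {F} {G} {x} (flatF , cycF) (flatG , cycG) F⊆G x∈G x∉F 0<F rG<
    with e , e∈F ← member F 0<F
    with g , g∉G ← nonmember G (ℕₚ.≤∧≢⇒< (∣p∣≤n G) λ ∣G∣≡n → ℕₚ.<⇒≢ rG< (cong r (∣p∣≡n⇒p≡⊤ ∣G∣≡n)))
    with H , F⊆H , (H⊆G , rH<) , max ← ∃-maximal {A = F} {P = λ H → H ⊆ G × r H < r (H ∪ ⁅ x ⁆)}
           (λ H → (H ⊆? G) ×-dec (r H ℕₚ.<? r (H ∪ ⁅ x ⁆))) (F⊆G , flatF x x∉F)
    = finish y-exists
    where
    x∉H : x ∉ H
    x∉H x∈H = ℕₚ.<⇒≱ rH< (rk-mono M (∪-lub id (⁅⁆⊆ x∈H)))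
    rHx : r (H ∪ ⁅ x ⁆) ≡ suc (r H)
    rHx = ℕₚ.≤-antisym rk-unit rH<
    -- For `z` outside `H`, maximality says that `H ∪ ⁅ z ⁆` spans `x`, so adding both elements
    -- gains at most one.
    spanned : ∀ {z} → z ∈ G → r ((H ∪ ⁅ x ⁆) ∪ ⁅ z ⁆) ≤ r (H ∪ ⁅ x ⁆)
    spanned {z} z∈G with z ∈? H
    ... | yes z∈H = rk-mono M (∪-lub id (⊆∪ˡ ∘ ⁅⁆⊆ z∈H))
    ... | no z∉H  = begin
      r ((H ∪ ⁅ x ⁆) ∪ ⁅ z ⁆)  ≤⟨ rk-mono M (∪-lub (∪-mono ⊆∪ˡ id) (λ z∈ → ⊆∪ˡ (q⊆p∪q H ⁅ z ⁆ z∈))) ⟩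
      r ((H ∪ ⁅ z ⁆) ∪ ⁅ x ⁆)  ≤⟨ ℕₚ.≮⇒≥ (λ lt → max z z∉H (∪-lub H⊆G (⁅⁆⊆ z∈G) , lt)) ⟩
      r (H ∪ ⁅ z ⁆)            ≤⟨ rk-unit ⟩
      suc (r H)                ≡⟨ rHx ⟨
      r (H ∪ ⁅ x ⁆)            ∎
      where open ℕₚ.≤-Reasoning
    rG≤ : r G ≤ suc (r H)
    rG≤ = ℕₚ.≤-trans (rk-spanned spanned) (ℕₚ.≤-reflexive rHx)
    -- Otherwise `H` would span `G - x`, which has the rank of `G` because `G` is cyclic; but `G`
    -- contains `H ∪ ⁅ x ⁆`.
    y-exists : ∃ λ y → y ∈ G × y ≢ x × r H < r (H ∪ ⁅ y ⁆)
    y-exists with Finₚ.any? (λ y → (y ∈? G) ×-dec ¬? (y Fin.≟ x) ×-dec (r H ℕₚ.<? r (H ∪ ⁅ y ⁆)))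
    ... | yes ex   = ex
    ... | no none  = ⊥-elim (ℕₚ.<⇒≱ rH< (begin
      r (H ∪ ⁅ x ⁆)  ≤⟨ rk-mono M (∪-lub H⊆G (⁅⁆⊆ x∈G)) ⟩
      r G            ≡⟨ cycG x x∈G ⟨
      r (G - x)      ≤⟨ rk-spanned (λ {z} z∈ → ℕₚ.≮⇒≥ λ lt → none (z , -⊆ z∈ , (λ { refl → x∉p-x G x z∈ }) , lt)) ⟩
      r H            ∎))
      where open ℕₚ.≤-Reasoning
    -- The minor contracts H - e, where e is an element of F ⊆ H.
    finish : (∃ λ y → y ∈ G × y ≢ x × r H < r (H ∪ ⁅ y ⁆)) → HasMinor M rkU
    finish (y , y∈G , y≢x , rHy) = loop-parallel-coloop (r H) -⊆ H⊆G (F⊆H e∈F) (x∉p-x H e)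
      x∈G y∈G x∉H (λ y∈H → ℕₚ.<⇒≱ rHy (rk-mono M (∪-lub id (⁅⁆⊆ y∈H)))) y≢x g∉G
      rC ℕₚ.≤-refl rG≤ (lift rH<) (lift rHy) flatG
      where
      rC : r (H - e) ≡ r H
      rC = cyclic-⊆ cycF F⊆H e∈F
      lift : ∀ {z} → r H < r (H ∪ ⁅ z ⁆) → r H < r ((H - e) ∪ ⁅ z ⁆)
      lift {z} lt = ℕₚ.<-≤-trans lt (ℕₚ.+-cancelʳ-≤ (r H) _ _
        (subst (λ t → r (H ∪ ⁅ z ⁆) + t ≤ r ((H - e) ∪ ⁅ z ⁆) + r H) rC
          (ℕₚ.≤-trans (diminishing -⊆) (ℕₚ.≤-reflexive (ℕₚ.+-comm (r H) _)))))

-- Permutations of the ground set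

lookup-ext : ∀ {X Y : Subset n} → (∀ i → lookup X i ≡ lookup Y i) → X ≡ Y
lookup-ext {X = X} {Y} eq = trans (sym (tabulate∘lookup X)) (trans (tabulate-cong eq) (tabulate∘lookup Y))

lookup-permImage : ∀ (σ : Permutation′ n) X i → lookup (permImage σ X) i ≡ lookup X (σ ⟨$⟩ˡ i)
lookup-permImage σ X i = lookup∘tabulate _ i

permImage-∩ : ∀ (σ : Permutation′ n) X Y → permImage σ X ∩ permImage σ Y ≡ permImage σ (X ∩ Y)
permImage-∩ σ X Y = lookup-ext λ i → begin
  lookup (permImage σ X ∩ permImage σ Y) i                  ≡⟨ lookup-zipWith _∧_ i (permImage σ X) (permImage σ Y) ⟩
  _                                                         ≡⟨ cong₂ _∧_ (lookup-permImage σ X i) (lookup-permImage σ Y i) ⟩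
  _                                                         ≡⟨ lookup-zipWith _∧_ (σ ⟨$⟩ˡ i) X Y ⟨
  lookup (X ∩ Y) (σ ⟨$⟩ˡ i)                                 ≡⟨ lookup-permImage σ (X ∩ Y) i ⟨
  lookup (permImage σ (X ∩ Y)) i                            ∎
  where open ≡-Reasoning

permImage-∁ : ∀ (σ : Permutation′ n) X → ∁ (permImage σ X) ≡ permImage σ (∁ X)
permImage-∁ σ X = lookup-ext λ i → begin
  lookup (∁ (permImage σ X)) i       ≡⟨ lookup-map i not (permImage σ X) ⟩
  not (lookup (permImage σ X) i)     ≡⟨ cong not (lookup-permImage σ X i) ⟩
  not (lookup X (σ ⟨$⟩ˡ i))          ≡⟨ lookup-map (σ ⟨$⟩ˡ i) not X ⟨
  lookup (∁ X) (σ ⟨$⟩ˡ i)            ≡⟨ lookup-permImage σ (∁ X) i ⟨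
  lookup (permImage σ (∁ X)) i       ∎
  where open ≡-Reasoning

permImage-flip : ∀ (σ : Permutation′ n) X → permImage (flip σ) (permImage σ X) ≡ X
permImage-flip σ X = lookup-ext λ i → trans (lookup-permImage (flip σ) (permImage σ X) i)
  (trans (lookup-permImage σ X _) (cong (lookup X) (Permutation.inverseˡ σ)))

∣permImage∣ : ∀ (σ : Permutation′ n) X → ∣ permImage σ X ∣ ≡ ∣ X ∣
∣permImage∣ σ X = begin
  ∣ permImage σ X ∣                                 ≡⟨ ∣∣-sum (permImage σ X) ⟩
  sum (λ i → indicator (lookup (permImage σ X) i))  ≡⟨ sum-cong-≗ (λ i → cong indicator (lookup-permImage σ X i)) ⟩
  sum (λ i → indicator (lookup X (σ ⟨$⟩ˡ i)))       ≡⟨ sum-permute (λ i → indicator (lookup X i)) (flip σ) ⟨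
  sum (λ i → indicator (lookup X i))                ≡⟨ ∣∣-sum X ⟨
  ∣ X ∣                                             ∎
  where
  open ≡-Reasoning
  indicator : Bool → ℕ
  indicator b = if b then 1 else 0
  ∣∣-sum : ∀ {n} (X : Subset n) → ∣ X ∣ ≡ sum (λ i → indicator (lookup X i))
  ∣∣-sum []            = refl
  ∣∣-sum (outside ∷ X) = ∣∣-sum X
  ∣∣-sum (inside ∷ X)  = cong suc (∣∣-sum X)

record _~_ (X Y : Subset n) : Set where
  constructor _,_
  field
    perm  : Permutation′ n
    image : permImage perm X ≡ Y

~-refl : A ~ A
~-refl {A = A} = Permutation.id , tabulate∘lookup A

~-sym : A ~ B → B ~ A
~-sym {A = A} (σ , refl) = flip σ , permImage-flip σ A

~-trans : A ~ B → B ~ C → A ~ C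
~-trans {A = A} (σ , refl) (τ , refl) = σ ∘ₚ τ , lookup-ext λ i →
  trans (lookup-permImage (σ ∘ₚ τ) A i)
    (sym (trans (lookup-permImage τ (permImage σ A) i) (lookup-permImage σ A _)))

~-∷ : ∀ b → A ~ B → (b ∷ A) ~ (b ∷ B)
~-∷ b (σ , refl) = lift₀ σ , refl

~-swap : ∀ a b → (a ∷ b ∷ A) ~ (b ∷ a ∷ A)
~-swap {A = A} a b = Permutation.swap Permutation.id , cong (λ X → b ∷ a ∷ X) (tabulate∘lookup A)

~-∣∣ : A ~ B → ∣ A ∣ ≡ ∣ B ∣
~-∣∣ {A = A} (σ , refl) = sym (∣permImage∣ σ A)

inside-first : ∀ (X : Subset (suc n)) → 0 < ∣ X ∣ → ∃ λ Y → X ~ (inside ∷ Y)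
inside-first         (inside ∷ X)  _   = X , ~-refl
inside-first {zero}  (outside ∷ []) ()
inside-first {suc n} (outside ∷ X) 0<X with Y , X~ ← inside-first X 0<X =
  outside ∷ Y , ~-trans (~-∷ outside X~) (~-swap outside inside)

private
  -- An element of `Y` is moved to its front and then swapped with the leading `outside`, so that
  -- both heads agree. The argument `same` is the claim for one element fewer, through which `∣∣≡⇒~`
  -- recurses.
  cross : (∀ (X Y : Subset (suc n)) → ∣ X ∣ ≡ ∣ Y ∣ → X ~ Y) →
          ∀ (X Y : Subset (suc n)) → suc ∣ X ∣ ≡ ∣ Y ∣ → (inside ∷ X) ~ (outside ∷ Y)
  cross same X Y eq with Y′ , Y~ ← inside-first Y (subst (0 <_) eq (s≤s z≤n)) =
    ~-sym (~-trans (~-∷ outside Y~) (~-trans (~-swap outside inside)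
      (~-∷ inside (~-sym (same X (outside ∷ Y′) (ℕₚ.suc-injective (trans eq (~-∣∣ Y~))))))))

∣∣≡⇒~ : ∀ (X Y : Subset n) → ∣ X ∣ ≡ ∣ Y ∣ → X ~ Y
∣∣≡⇒~ []            []            _  = ~-refl
∣∣≡⇒~ (inside ∷ X)  (inside ∷ Y)  eq = ~-∷ inside (∣∣≡⇒~ X Y (ℕₚ.suc-injective eq))
∣∣≡⇒~ (outside ∷ X) (outside ∷ Y) eq = ~-∷ outside (∣∣≡⇒~ X Y eq)
∣∣≡⇒~ {suc zero}    (inside ∷ []) (outside ∷ []) ()
∣∣≡⇒~ {suc zero}    (outside ∷ []) (inside ∷ []) ()
∣∣≡⇒~ {suc (suc n)} (inside ∷ X)  (outside ∷ Y) eq = cross ∣∣≡⇒~ X Y eq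
∣∣≡⇒~ {suc (suc n)} (outside ∷ X) (inside ∷ Y)  eq = ~-sym (cross ∣∣≡⇒~ Y X (sym eq))

∃-∣∣≡ : ∀ {m} n → m ≤ n → ∃ λ (X : Subset n) → ∣ X ∣ ≡ m
∃-∣∣≡ {m} n       z≤n       = ⊥ , ∣⊥∣≡0 n
∃-∣∣≡ (suc n) (s≤s m≤n) with X , eq ← ∃-∣∣≡ n m≤n = inside ∷ X , cong suc eq

-- Sums over all subsets

∈-allSubsets : ∀ (X : Subset n) → X ∈ˡ allSubsets n
∈-allSubsets []            = Any.here refl
∈-allSubsets (inside ∷ X)  = ∈-++⁺ˡ (∈-map⁺ _ (∈-allSubsets X))
∈-allSubsets (outside ∷ X) = ∈-++⁺ʳ _ (∈-map⁺ _ (∈-allSubsets X))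

allSubsets-unique : ∀ n → Unique (allSubsets n)
allSubsets-unique zero    = All.[] AllPairs.∷ AllPairs.[]
allSubsets-unique (suc n) = ++⁺ (map⁺ ∷-inj (allSubsets-unique n)) (map⁺ ∷-inj (allSubsets-unique n)) disjoint
  where
  ∷-inj : ∀ {b} {X Y : Subset n} → _≡_ {A = Subset (suc n)} (b ∷ X) (b ∷ Y) → X ≡ Y
  ∷-inj refl = refl
  disjoint : ∀ {X} → ¬ (X ∈ˡ List.map (inside ∷_) (allSubsets n) × X ∈ˡ List.map (outside ∷_) (allSubsets n))
  disjoint (X∈ , X∈′) with _ , _ , refl ← ∈-map⁻ _ X∈ with _ , _ , () ← ∈-map⁻ _ X∈′

-- The list of images is duplicate-free and has the same members as `allSubsets n`, so it is a
-- rearrangement of it.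
∑-allSubsets-permImage : ∀ (σ : Permutation′ n) (g : Subset n → ℤ) →
                         ∑ (g ∘ permImage σ) (allSubsets n) ≡ ∑ g (allSubsets n)
∑-allSubsets-permImage {n} σ g = trans (sym (∑-map g (permImage σ) (allSubsets n))) (∑-↭ g
  (∼bag⇒↭ (unique∧set⇒bag (map⁺ inj (allSubsets-unique n)) (allSubsets-unique n) λ {X} →
    mk⇔ (λ _ → ∈-allSubsets X)
        (λ _ → subst (_∈ˡ List.map (permImage σ) (allSubsets n)) (permImage-flip (flip σ) X)
                 (∈-map⁺ (permImage σ) (∈-allSubsets (permImage (flip σ) X)))))))
  where
  inj : ∀ {X Y} → permImage σ X ≡ permImage σ Y → X ≡ Y
  inj {X} {Y} eq = trans (sym (permImage-flip σ X)) (trans (cong (permImage (flip σ)) eq) (permImage-flip σ Y))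

∑-allSubsets-single : ∀ (X : Subset n) {g : Subset n → ℤ} → (∀ Y → Y ≢ X → g Y ≡ 0ℤ) →
                      ∑ g (allSubsets n) ≡ g X
∑-allSubsets-single {n} X = ∑-single (allSubsets-unique n) (∈-allSubsets X)

-- The bases of Λ k ρ F below are the k-subsets meeting F in at most ρ elements: in
-- the paper's Λ_{r,k,h,n}, F is the complement of {1, …, h} and ρ = k - r.  preΛ is
-- its rank function before truncation to rank k.
preΛ : ℕ → Subset n → Subset n → ℕ
preΛ ρ F X = ∣ X ∩ ∁ F ∣ + ρ ⊓ ∣ X ∩ F ∣

λrk : ℕ → ℕ → Subset n → Subset n → ℕ
λrk k ρ F X = k ⊓ preΛ ρ F X

-- Truncation preserves submodularity: if `a` or `b` reaches `k` then so does `u`, and monotonicity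
-- is all that remains; otherwise the right side is untouched and the left can only shrink. It
-- serves for both truncations in Λ, at `ρ` and at `k`.
⊓-submodular : ∀ k {a b u w} → w ≤ a → w ≤ b → a ≤ u → b ≤ u → u + w ≤ a + b →
               k ⊓ u + k ⊓ w ≤ k ⊓ a + k ⊓ b
⊓-submodular k {a} {b} {u} {w} w≤a w≤b a≤u b≤u le with ℕₚ.≤-total k a | ℕₚ.≤-total k b
... | inj₁ k≤a | _        rewrite ℕₚ.m≤n⇒m⊓n≡m k≤a | ℕₚ.m≤n⇒m⊓n≡m (ℕₚ.≤-trans k≤a a≤u) =
  ℕₚ.+-monoʳ-≤ k (ℕₚ.⊓-monoʳ-≤ k w≤b)
... | inj₂ _   | inj₁ k≤b rewrite ℕₚ.m≤n⇒m⊓n≡m k≤b | ℕₚ.m≤n⇒m⊓n≡m (ℕₚ.≤-trans k≤b b≤u) | ℕₚ.+-comm (k ⊓ a) k =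
  ℕₚ.+-monoʳ-≤ k (ℕₚ.⊓-monoʳ-≤ k w≤a)
... | inj₂ a≤k | inj₂ b≤k rewrite ℕₚ.m≥n⇒m⊓n≡n a≤k | ℕₚ.m≥n⇒m⊓n≡n b≤k =
  ℕₚ.≤-trans (ℕₚ.+-mono-≤ (ℕₚ.m⊓n≤n k u) (ℕₚ.m⊓n≤n k w)) le

∩-monoˡ : ∀ (A F : Subset n) → A ⊆ B → ∣ A ∩ F ∣ ≤ ∣ B ∩ F ∣
∩-monoˡ A F A⊆B = p⊆q⇒∣p∣≤∣q∣ λ x∈ → let x∈A , x∈F = x∈p∩q⁻ A F x∈ in x∈p∩q⁺ (A⊆B x∈A , x∈F)

∩-strictˡ : ∀ (A F : Subset n) → A ⊆ B → e ∈ B → e ∈ F → e ∉ A → ∣ A ∩ F ∣ < ∣ B ∩ F ∣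
∩-strictˡ A F A⊆B e∈B e∈F e∉A = p⊂q⇒∣p∣<∣q∣
  ( (λ x∈ → let x∈A , x∈F = x∈p∩q⁻ A F x∈ in x∈p∩q⁺ (A⊆B x∈A , x∈F))
  , _ , x∈p∩q⁺ (e∈B , e∈F) , λ e∈ → e∉A (proj₁ (x∈p∩q⁻ A F e∈)))

∩-modular : ∀ (F X Y : Subset n) → ∣ (X ∪ Y) ∩ F ∣ + ∣ (X ∩ Y) ∩ F ∣ ≡ ∣ X ∩ F ∣ + ∣ Y ∩ F ∣
∩-modular F X Y = trans
  (cong₂ (λ U I → ∣ U ∣ + ∣ I ∣) (∩-distribʳ-∪ F X Y) (⊆-antisym
    (λ x∈ → let x∈X∩Y , x∈F = x∈p∩q⁻ (X ∩ Y) F x∈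
                x∈X , x∈Y   = x∈p∩q⁻ X Y x∈X∩Y
            in x∈p∩q⁺ (x∈p∩q⁺ (x∈X , x∈F) , x∈p∩q⁺ (x∈Y , x∈F)))
    (λ x∈ → let x∈X∩F , x∈Y∩F = x∈p∩q⁻ (X ∩ F) (Y ∩ F) x∈
                x∈X , x∈F     = x∈p∩q⁻ X F x∈X∩F
            in x∈p∩q⁺ (x∈p∩q⁺ (x∈X , proj₁ (x∈p∩q⁻ Y F x∈Y∩F)) , x∈F))))
  (∣∪∣+∣∩∣ (X ∩ F) (Y ∩ F))

module _ {n : ℕ} (k ρ : ℕ) (F : Subset n) where

  private
    pre = preΛ ρ F

    pre-mono : ∀ A {B} → A ⊆ B → pre A ≤ pre B
    pre-mono A A⊆B = ℕₚ.+-mono-≤ (∩-monoˡ A (∁ F) A⊆B) (ℕₚ.⊓-monoʳ-≤ ρ (∩-monoˡ A F A⊆B))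

    pre-submod : ∀ X Y → pre (X ∪ Y) + pre (X ∩ Y) ≤ pre X + pre Y
    pre-submod X Y = begin
      pre (X ∪ Y) + pre (X ∩ Y)
        ≡⟨ ℕ-semigroup.interchange ∣ (X ∪ Y) ∩ ∁ F ∣ _ _ _ ⟩
      (∣ (X ∪ Y) ∩ ∁ F ∣ + ∣ (X ∩ Y) ∩ ∁ F ∣) + (ρ ⊓ ∣ (X ∪ Y) ∩ F ∣ + ρ ⊓ ∣ (X ∩ Y) ∩ F ∣)
        ≤⟨ ℕₚ.+-mono-≤ (ℕₚ.≤-reflexive (∩-modular (∁ F) X Y))
             (⊓-submodular ρ (∩-monoˡ (X ∩ Y) F (p∩q⊆p X Y)) (∩-monoˡ (X ∩ Y) F (p∩q⊆q X Y))
                (∩-monoˡ X F (p⊆p∪q Y)) (∩-monoˡ Y F (q⊆p∪q X Y)) (ℕₚ.≤-reflexive (∩-modular F X Y))) ⟩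
      (∣ X ∩ ∁ F ∣ + ∣ Y ∩ ∁ F ∣) + (ρ ⊓ ∣ X ∩ F ∣ + ρ ⊓ ∣ Y ∩ F ∣)
        ≡⟨ ℕ-semigroup.interchange ∣ X ∩ ∁ F ∣ _ _ _ ⟩
      pre X + pre Y ∎
      where
      open ℕₚ.≤-Reasoning

    pre-bounded : ∀ X → pre X ≤ ∣ X ∣
    pre-bounded X = ℕₚ.≤-trans (ℕₚ.+-monoʳ-≤ ∣ X ∩ ∁ F ∣ (ℕₚ.m⊓n≤n ρ _))
      (ℕₚ.≤-reflexive (trans (ℕₚ.+-comm ∣ X ∩ ∁ F ∣ _) (∣∩∣+∣∩∁∣ X F)))

  Λ : Matroid n
  Λ = record
    { rk         = λrk k ρ F
    ; rk-bounded = λ X → ℕₚ.≤-trans (ℕₚ.m⊓n≤n k _) (pre-bounded X)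
    ; rk-mono    = λ {X} X⊆Y → ℕₚ.⊓-monoʳ-≤ k (pre-mono X X⊆Y)
    ; rk-submod  = λ X Y → ⊓-submodular k (pre-mono (X ∩ Y) (p∩q⊆p X Y)) (pre-mono (X ∩ Y) (p∩q⊆q X Y))
                     (pre-mono X (p⊆p∪q Y)) (pre-mono Y (q⊆p∪q X Y)) (pre-submod X Y)
    }

  rank-Λ : ρ ≤ ∣ F ∣ → k ≤ ∣ ∁ F ∣ + ρ → rank Λ ≡ k
  rank-Λ ρ≤ k≤ = ℕₚ.m≤n⇒m⊓n≡m (ℕₚ.≤-trans k≤ (ℕₚ.≤-reflexive (sym (cong₂ _+_
    (cong ∣_∣ (∩-identityˡ (∁ F))) (trans (cong (λ X → ρ ⊓ ∣ X ∣) (∩-identityˡ F)) (ℕₚ.m≤n⇒m⊓n≡m ρ≤))))))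

-- The matroids Λ are cuspidal

module _ {n ρ : ℕ} {F : Subset n} (A B : Subset n) (A⊆B : A ⊆ B) where

  preΛ-<-outside : ∀ {e} → e ∈ B → e ∉ A → e ∉ F → preΛ ρ F A < preΛ ρ F B
  preΛ-<-outside e∈B e∉A e∉F =
    ℕₚ.+-mono-<-≤ (∩-strictˡ A (∁ F) A⊆B e∈B (x∉p⇒x∈∁p e∉F) e∉A) (ℕₚ.⊓-monoʳ-≤ ρ (∩-monoˡ A F A⊆B))

  preΛ-<-inside : ∀ {e} → e ∈ B → e ∉ A → e ∈ F → ∣ B ∩ F ∣ ≤ ρ ⊎ ∣ A ∩ F ∣ < ρ → preΛ ρ F A < preΛ ρ F B
  preΛ-<-inside e∈B e∉A e∈F small = ℕₚ.+-mono-≤-< (∩-monoˡ A (∁ F) A⊆B)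
    (ℕₚ.≤-<-trans (ℕₚ.m⊓n≤n ρ _) (ℕₚ.⊓-pres-m< ([ ℕₚ.<-≤-trans strict , id ]′ small) strict))
    where strict = ∩-strictˡ A F A⊆B e∈B e∈F e∉A

  preΛ-≤ : (∀ {x} → x ∈ B → x ∉ F → x ∈ A) → ρ ≤ ∣ A ∩ F ∣ → preΛ ρ F B ≤ preΛ ρ F A
  preΛ-≤ sub ρ≤ = ℕₚ.+-mono-≤
    (p⊆q⇒∣p∣≤∣q∣ λ x∈ → let x∈B , x∈∁F = x∈p∩q⁻ B (∁ F) x∈ in x∈p∩q⁺ (sub x∈B (x∈∁p⇒x∉p x∈∁F) , x∈∁F))
    (ℕₚ.≤-trans (ℕₚ.m⊓n≤m ρ _) (ℕₚ.≤-reflexive (sym (ℕₚ.m≤n⇒m⊓n≡m ρ≤))))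

λrk<k⇒preΛ : ∀ {t} → λrk k ρ F X ≤ t → t < k → λrk k ρ F X ≡ preΛ ρ F X
λrk<k⇒preΛ {k = k} {ρ = ρ} {F = F} {X = X} ≤t t<k with ℕₚ.≤-total k (preΛ ρ F X)
... | inj₂ pre≤k = ℕₚ.m≥n⇒m⊓n≡n pre≤k
... | inj₁ k≤pre = ⊥-elim (ℕₚ.<⇒≱ (ℕₚ.≤-<-trans ≤t t<k) (ℕₚ.≤-reflexive (sym (ℕₚ.m≤n⇒m⊓n≡m k≤pre))))

-- A flat of rank `k` is everything. Below rank `k` the function `preΛ` applies: elements off `F`
-- are coloops of `G`, so `G ⊆ F`; with at most `ρ` elements `G` is independent, hence empty; with
-- at least `ρ` it spans `F`.
Λ-cyclicFlat : ∀ {G} → IsCyclicFlat (Λ k ρ F) G → (∀ {x} → x ∈ G) ⊎ (∀ {x} → x ∉ G) ⊎ (G ⊆ F × F ⊆ G)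
Λ-cyclicFlat {k = k} {ρ = ρ} {F = F} {G} (flat , cyclic) with λrk k ρ F G ℕₚ.<? k
... | no rG≮k = inj₁ λ {x} → decidable-stable (x ∈? G) λ x∉G →
  rG≮k (ℕₚ.<-≤-trans (flat x x∉G) (ℕₚ.m⊓n≤m k _))
... | yes rG<k = inj₂ (split (ℕₚ.≤-total ∣ G ∩ F ∣ ρ))
  where
  rG : λrk k ρ F G ≡ preΛ ρ F G
  rG = λrk<k⇒preΛ {X = G} ℕₚ.≤-refl rG<k
  pre-≮ : ∀ {x} → x ∈ G → ¬ (preΛ ρ F (G - x) < preΛ ρ F G)
  pre-≮ {x} x∈G lt = ℕₚ.<⇒≢ (ℕₚ.≤-<-trans (ℕₚ.m⊓n≤n k _) lt) (trans (cyclic x x∈G) rG)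
  G⊆F : G ⊆ F
  G⊆F {x} x∈G = decidable-stable (x ∈? F) λ x∉F →
    pre-≮ x∈G (preΛ-<-outside (G - x) G -⊆ x∈G (x∉p-x G x) x∉F)
  split : ∣ G ∩ F ∣ ≤ ρ ⊎ ρ ≤ ∣ G ∩ F ∣ → (∀ {x} → x ∉ G) ⊎ (G ⊆ F × F ⊆ G)
  split (inj₁ G≤ρ) = inj₁ λ {x} x∈G →
    pre-≮ x∈G (preΛ-<-inside (G - x) G -⊆ x∈G (x∉p-x G x) (G⊆F x∈G) (inj₁ G≤ρ))
  split (inj₂ ρ≤G) = inj₂ (G⊆F , λ {x} x∈F → decidable-stable (x ∈? G) λ x∉G →
    ℕₚ.<⇒≱ (flat x x∉G) (ℕₚ.⊓-monoʳ-≤ k (preΛ-≤ G (G ∪ ⁅ x ⁆) ⊆∪ˡ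
      (λ {y} y∈ y∉F → [ id , (λ y∈⁅x⁆ → ⊥-elim (y∉F (⁅⁆⊆ x∈F y∈⁅x⁆))) ]′ (x∈p∪q⁻ G _ y∈)) ρ≤G)))

Λ-Schubert : Schubert (Λ k ρ F)
Λ-Schubert G H cG cH with Λ-cyclicFlat cG | Λ-cyclicFlat cH
... | inj₁ full                | _                        = inj₂ λ _ → full
... | inj₂ (inj₁ empty)        | _                        = inj₁ λ x∈ → ⊥-elim (empty x∈)
... | inj₂ (inj₂ _)            | inj₁ full                = inj₁ λ _ → full
... | inj₂ (inj₂ _)            | inj₂ (inj₁ empty)        = inj₂ λ x∈ → ⊥-elim (empty x∈)
... | inj₂ (inj₂ (G⊆F , F⊆G))  | inj₂ (inj₂ (H⊆F , F⊆H))  = inj₁ λ x∈ → F⊆H (G⊆F x∈)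

-- The loop of a forbidden minor can only be an element of `F` over a `C` that already has `ρ`
-- elements in `F`. The two parallel elements are not loops over `C`, so they lie off `F`; but then
-- together they raise `preΛ` by two, although the pair has rank one in the minor.
Λ-ElementarySplit : ElementarySplit (Λ k ρ F)
Λ-ElementarySplit {k = k} {ρ = ρ} {F = F} (C , f , f-inj , f∉C , rk≗) = ℕₚ.<⇒≱
  (ℕₚ.≤-<-trans (subst (_< pre I₁) preC
      (preΛ-<-outside C I₁ (C⊆ ⁅ one ⁆) (f∈ ⁅ one ⁆ (there here)) (f∉C one) (f-outside one (rk≗ ⁅ one ⁆))))
    (preΛ-<-outside I₁ I₁₂ (∪-mono {A = mapImage f ⁅ one ⁆} I₁⊆ id) (f∈ ⁅12⁆ two∈)
       (λ f₂∈ → [ f₂∉ , f∉C two ]′ (x∈p∪q⁻ (mapImage f ⁅ one ⁆) C f₂∈)) (f-outside two (rk≗ ⁅ two ⁆))))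
  (preI ⁅12⁆ (ℕₚ.≤-reflexive (rk≗ ⁅12⁆)))
  where
  one two : Fin 4
  one = suc zero
  two = suc (suc zero)
  ⁅12⁆ : Subset 4
  ⁅12⁆ = ⁅ one ⁆ ∪ ⁅ two ⁆
  pre = preΛ ρ F
  I : Subset 4 → _
  I X = mapImage f X ∪ C
  I₁ = I ⁅ one ⁆
  I₁₂ = I ⁅12⁆
  t = λrk k ρ F C
  two∈ : two ∈ ⁅12⁆
  two∈ = there (there here)
  I₁⊆ : mapImage f ⁅ one ⁆ ⊆ mapImage f ⁅12⁆
  I₁⊆ j∈ with i , i∈ , refl ← ∈-mapImage⁻ f {X = ⁅ one ⁆} j∈ = ∈-mapImage⁺ f (p⊆p∪q {p = ⁅ one ⁆} ⁅ two ⁆ i∈)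
  f₂∉ : f two ∉ mapImage f ⁅ one ⁆
  f₂∉ f₂∈ with i , i∈ , fi≡ ← ∈-mapImage⁻ f {X = ⁅ one ⁆} f₂∈
    with () ← x∈⁅y⁆⇒x≡y one (subst (_∈ ⁅ one ⁆) (f-inj fi≡) i∈)
  C⊆ : ∀ X → C ⊆ I X
  C⊆ X = x∈p∪q⁺ ∘ inj₂
  f∈ : ∀ X {i} → i ∈ X → f i ∈ I X
  f∈ X i∈X = x∈p∪q⁺ (inj₁ (∈-mapImage⁺ f i∈X))
  -- The coloop enters here: the minor has rank 2, so truncation at `k` is inactive on sets of rank
  -- at most `t + 1`.
  t+2≤k : suc t < k
  t+2≤k = ℕₚ.m≤o∸n⇒m+n≤o 2 (ℕₚ.m⊓n≤m k _)
    (ℕₚ.≤-trans (ℕₚ.≤-reflexive (sym (rk≗ ⊤))) (ℕₚ.∸-monoˡ-≤ t (ℕₚ.m⊓n≤m k _)))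
  preI : ∀ X → λrk k ρ F (I X) ∸ t ≤ 1 → pre (I X) ≤ suc t
  preI X ≤1 = ℕₚ.≤-trans (ℕₚ.≤-reflexive (sym (λrk<k⇒preΛ {X = I X} le t+2≤k))) le
    where
    le : λrk k ρ F (I X) ≤ suc t
    le = ℕₚ.≤-trans (ℕₚ.m≤n+m∸n _ t) (ℕₚ.≤-trans (ℕₚ.+-monoʳ-≤ t ≤1) (ℕₚ.≤-reflexive (ℕₚ.+-comm t 1)))
  preC : pre C ≡ t
  preC = sym (λrk<k⇒preΛ {X = C} ℕₚ.≤-refl (ℕₚ.<-trans (ℕₚ.n<1+n t) t+2≤k))
  pre-loop : pre (I ⁅ zero ⁆) ≤ pre C
  pre-loop = subst (_≤ pre C) (λrk<k⇒preΛ {X = I ⁅ zero ⁆} le (ℕₚ.<-trans (ℕₚ.n<1+n t) t+2≤k))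
    (ℕₚ.≤-trans le (ℕₚ.≤-reflexive (sym preC)))
    where
    le : λrk k ρ F (I ⁅ zero ⁆) ≤ t
    le = ℕₚ.m∸n≡0⇒m≤n (rk≗ ⁅ zero ⁆)
  loop∈F : f zero ∈ F
  loop∈F = decidable-stable (f zero ∈? F) λ ∉F →
    ℕₚ.<⇒≱ (preΛ-<-outside C (I ⁅ zero ⁆) (C⊆ ⁅ zero ⁆) (f∈ ⁅ zero ⁆ here) (f∉C zero) ∉F) pre-loop
  ρ≤C : ρ ≤ ∣ C ∩ F ∣
  ρ≤C = ℕₚ.≮⇒≥ λ C<ρ →
    ℕₚ.<⇒≱ (preΛ-<-inside C (I ⁅ zero ⁆) (C⊆ ⁅ zero ⁆) (f∈ ⁅ zero ⁆ here) (f∉C zero) loop∈F (inj₂ C<ρ)) pre-loop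
  f-outside : ∀ i → λrk k ρ F (I ⁅ i ⁆) ∸ t ≡ 1 → f i ∉ F
  f-outside i eq fi∈F = ℕₚ.1+n≢0 (trans (sym eq) (ℕₚ.m≤n⇒m∸n≡0 (ℕₚ.≤-trans (ℕₚ.m⊓n≤n k _)
      (ℕₚ.≤-trans (preΛ-≤ C (I ⁅ i ⁆) (C⊆ ⁅ i ⁆) only ρ≤C) (ℕₚ.≤-reflexive preC)))))
    where
    only : ∀ {x} → x ∈ I ⁅ i ⁆ → x ∉ F → x ∈ C
    only x∈ x∉F with x∈p∪q⁻ (mapImage f ⁅ i ⁆) C x∈
    ... | inj₂ x∈C  = x∈C
    ... | inj₁ x∈Im with j , j∈ , refl ← ∈-mapImage⁻ f {X = ⁅ i ⁆} x∈Im =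
      ⊥-elim (x∉F (subst (λ j → f j ∈ F) (sym (x∈⁅y⁆⇒x≡y i j∈)) fi∈F))

-- Classification of cuspidal matroids

∣∣≤suc∣-∣ : ∀ {n} (X : Subset n) e → ∣ X ∣ ≤ suc ∣ X - e ∣
∣∣≤suc∣-∣ X e = begin
  ∣ X ∣                                       ≤⟨ p⊆q⇒∣p∣≤∣q∣ X⊆ ⟩
  ∣ (X - e) ∪ ⁅ e ⁆ ∣                         ≤⟨ ℕₚ.m≤m+n _ _ ⟩
  ∣ (X - e) ∪ ⁅ e ⁆ ∣ + ∣ (X - e) ∩ ⁅ e ⁆ ∣   ≡⟨ ∣∪∣+∣∩∣ (X - e) ⁅ e ⁆ ⟩
  ∣ X - e ∣ + ∣ ⁅ e ⁆ ∣                       ≡⟨ cong (∣ X - e ∣ +_) (∣⁅x⁆∣≡1 e) ⟩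
  ∣ X - e ∣ + 1                               ≡⟨ ℕₚ.+-comm _ 1 ⟩
  suc ∣ X - e ∣                               ∎
  where
  open ℕₚ.≤-Reasoning
  X⊆ : X ⊆ (X - e) ∪ ⁅ e ⁆
  X⊆ {x} x∈ with x Fin.≟ e
  ... | yes refl = e∈∪⁅e⁆
  ... | no x≢e   = x∈p∪q⁺ (inj₁ (x∈p∧x≢y⇒x∈p-y x∈ x≢e))

module _ {n} (M : Matroid n) where

  open MatroidProperties M

  private
    r = rk M

  -- Elements whose removal lowers the rank are deleted one at a time. Each deletion costs one
  -- element and at least one unit of rank, so nullity does not drop; the inequality states this
  -- without subtraction.
  cyclic-part : ∀ X → ∃ λ Y → Y ⊆ X × IsCyclic M Y × r Y + ∣ X ∣ ≤ r X + ∣ Y ∣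
  cyclic-part X = go ∣ X ∣ X ℕₚ.≤-refl
    where
    go : ∀ d X → ∣ X ∣ ≤ d → ∃ λ Y → Y ⊆ X × IsCyclic M Y × r Y + ∣ X ∣ ≤ r X + ∣ Y ∣
    go d X X≤d with Finₚ.any? (λ e → (e ∈? X) ×-dec (r (X - e) ℕₚ.<? r X))
    ... | no none = X , id , (λ e e∈X → ℕₚ.≤-antisym (rk-mono M -⊆) (ℕₚ.≮⇒≥ λ lt → none (e , e∈X , lt))) , ℕₚ.≤-refl
    go zero X X≤0    | yes (e , e∈X , lt) = ⊥-elim (ℕₚ.n≮0 (ℕₚ.<-≤-trans (x∈p⇒∣p-x∣<∣p∣ e∈X) X≤0))
    go (suc d) X X≤d | yes (e , e∈X , lt)
      with Y , Y⊆ , cyc , le ← go d (X - e) (ℕₚ.≤-pred (ℕₚ.<-≤-trans (x∈p⇒∣p-x∣<∣p∣ e∈X) X≤d))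
      = Y , -⊆ ∘ Y⊆ , cyc , (begin
        r Y + ∣ X ∣              ≤⟨ ℕₚ.+-monoʳ-≤ (r Y) (∣∣≤suc∣-∣ X e) ⟩
        r Y + suc ∣ X - e ∣      ≡⟨ ℕₚ.+-suc (r Y) _ ⟩
        suc (r Y + ∣ X - e ∣)    ≤⟨ s≤s le ⟩
        suc (r (X - e)) + ∣ Y ∣  ≤⟨ ℕₚ.+-monoˡ-≤ ∣ Y ∣ lt ⟩
        r X + ∣ Y ∣              ∎)
      where open ℕₚ.≤-Reasoning

  ProperCyclicFlat : Subset n → Set
  ProperCyclicFlat F = IsCyclicFlat M F × r F < rank M × r F < ∣ F ∣

  -- The flat is the closure of the cyclic part of `X`. The final inequality says that the elements
  -- of `X` off `F` count in full over `F`; it becomes the lower bound in the classification.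
  degenerate⇒properCyclicFlat : ∀ X → r X < rank M → r X < ∣ X ∣ →
                                ∃ λ F → ProperCyclicFlat F × r F + ∣ X ∩ ∁ F ∣ ≤ r X
  degenerate⇒properCyclicFlat X rX<k rX<X
    with Y , Y⊆X , cycY , le ← cyclic-part X
    with F , Y⊆F , rF , flatF ← closure Y
    = F , ((flatF , cycF) , ℕₚ.≤-<-trans rF≤rX rX<k , rF<F) , ℕₚ.+-cancelʳ-≤ ∣ Y ∣ _ _ (begin
      r F + ∣ X ∩ ∁ F ∣ + ∣ Y ∣    ≡⟨ ℕₚ.+-assoc (r F) _ _ ⟩
      r F + (∣ X ∩ ∁ F ∣ + ∣ Y ∣)
        ≤⟨ ℕₚ.+-mono-≤ (ℕₚ.≤-reflexive rF) (ℕₚ.+-monoʳ-≤ ∣ X ∩ ∁ F ∣ (p⊆q⇒∣p∣≤∣q∣ (∩-glb {A = X} {B = F} Y⊆X Y⊆F))) ⟩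
      r Y + (∣ X ∩ ∁ F ∣ + ∣ X ∩ F ∣) ≡⟨ cong (r Y +_) (trans (ℕₚ.+-comm ∣ X ∩ ∁ F ∣ _) (∣∩∣+∣∩∁∣ X F)) ⟩
      r Y + ∣ X ∣                  ≤⟨ le ⟩
      r X + ∣ Y ∣                  ∎)
    where
    open ℕₚ.≤-Reasoning
    rF≤rX : r F ≤ r X
    rF≤rX = ℕₚ.≤-trans (ℕₚ.≤-reflexive rF) (rk-mono M Y⊆X)
    rF<F : r F < ∣ F ∣
    rF<F = subst (_< ∣ F ∣) (sym rF) (ℕₚ.<-≤-trans
      (ℕₚ.+-cancelʳ-< ∣ X ∣ _ _ (ℕₚ.≤-<-trans le (subst (_< ∣ Y ∣ + ∣ X ∣) (ℕₚ.+-comm ∣ Y ∣ (r X)) (ℕₚ.+-monoʳ-< ∣ Y ∣ rX<X))))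
      (p⊆q⇒∣p∣≤∣q∣ Y⊆F))
    cycF : IsCyclic M F
    cycF e e∈F with e ∈? Y
    ... | yes e∈Y = cyclic-⊆ cycY Y⊆F e∈Y
    ... | no e∉Y  = ℕₚ.≤-antisym (rk-mono M -⊆) (ℕₚ.≤-trans (ℕₚ.≤-reflexive rF)
                      (rk-mono M λ {x} x∈Y → x∈p∧x≢y⇒x∈p-y (Y⊆F x∈Y) λ { refl → e∉Y x∈Y }))

  module _ (cuspidal : Cuspidal M) where

    properCyclicFlat-unique : ∀ {F G} → ProperCyclicFlat F → ProperCyclicFlat G → F ≡ G
    properCyclicFlat-unique pF pG = ⊆-antisym (sub pF pG) (sub pG pF)
      where
      sub : ∀ {F G} → ProperCyclicFlat F → ProperCyclicFlat G → F ⊆ G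
      sub {F} {G} (cF , rF< , rF<F) (cG , _ , rG<G) with proj₁ cuspidal F G cF cG
      ... | inj₁ F⊆G = F⊆G
      ... | inj₂ G⊆F = λ x∈F → decidable-stable (_ ∈? G) λ x∉G →
        proj₂ cuspidal (two-cyclic-flats⇒minor cG cF G⊆F x∈F x∉G (ℕₚ.≤-<-trans z≤n rG<G) rF<)

    -- If every set spans or is independent, the matroid is uniform, written with `F ≡ ⊤` and `ρ`
    -- the full rank. Otherwise `F` is the proper cyclic flat and `ρ` its rank.
    cuspidal⇒Λ : ∃₂ λ F ρ → ((F ≡ ⊤ × ρ ≡ rank M) ⊎ (ρ < rank M × ρ < ∣ F ∣)) ×
                 (∀ X → r X ≡ λrk (rank M) ρ F X)
    cuspidal⇒Λ with anySubset? (λ X → (r X ℕₚ.<? rank M) ×-dec (r X ℕₚ.<? ∣ X ∣))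
    ... | no none = ⊤ , rank M , inj₁ (refl , refl) , λ X → ℕₚ.≤-antisym
      (ℕₚ.⊓-glb (rk-mono M ⊆⊤) (subst (r X ≤_) (sym (pre⊤ X)) (ℕₚ.⊓-glb (rk-mono M ⊆⊤) (rk-bounded M X))))
      (ℕₚ.≮⇒≥ λ lt → none (X , ℕₚ.<-≤-trans lt (ℕₚ.m⊓n≤m _ _) ,
        ℕₚ.<-≤-trans lt (ℕₚ.≤-trans (ℕₚ.m⊓n≤n _ _) (ℕₚ.≤-trans (ℕₚ.≤-reflexive (pre⊤ X)) (ℕₚ.m⊓n≤n _ _)))))
      where
      pre⊤ : ∀ X → preΛ (rank M) ⊤ X ≡ rank M ⊓ ∣ X ∣
      pre⊤ X = cong₂ _+_
        (ℕₚ.n≤0⇒n≡0 (ℕₚ.≤-trans (∣p∩q∣≤∣q∣ X (∁ ⊤))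
          (ℕₚ.≤-reflexive (trans (∣∁p∣≡n∸∣p∣ {n} ⊤) (ℕₚ.m≤n⇒m∸n≡0 (ℕₚ.≤-reflexive (sym (∣⊤∣≡n n))))))))
        (cong (λ Y → rank M ⊓ ∣ Y ∣) (∩-identityʳ X))
    ... | yes (X₀ , rX₀<k , rX₀<X₀) with F , pF@(_ , rF<k , rF<F) , _ ← degenerate⇒properCyclicFlat X₀ rX₀<k rX₀<X₀
      = F , r F , inj₂ (rF<k , rF<F) , λ X → ℕₚ.≤-antisym (ℕₚ.⊓-glb (rk-mono M ⊆⊤) (upper X)) (lower X)
      where
      upper : ∀ X → r X ≤ preΛ (r F) F X
      upper X = begin
        r X                                ≤⟨ rk-mono M X⊆ ⟩
        r ((X ∩ ∁ F) ∪ (X ∩ F))            ≤⟨ ℕₚ.m≤m+n _ _ ⟩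
        _                                  ≤⟨ rk-submod M (X ∩ ∁ F) (X ∩ F) ⟩
        r (X ∩ ∁ F) + r (X ∩ F)            ≤⟨ ℕₚ.+-mono-≤ (rk-bounded M _) (ℕₚ.⊓-glb (rk-mono M (p∩q⊆q X F)) (rk-bounded M _)) ⟩
        preΛ (r F) F X                     ∎
        where
        open ℕₚ.≤-Reasoning
        X⊆ : X ⊆ (X ∩ ∁ F) ∪ (X ∩ F)
        X⊆ {x} x∈X with x ∈? F
        ... | yes x∈F = x∈p∪q⁺ (inj₂ (x∈p∩q⁺ (x∈X , x∈F)))
        ... | no x∉F  = x∈p∪q⁺ (inj₁ (x∈p∩q⁺ (x∈X , x∉p⇒x∈∁p x∉F)))
      -- A set neither spanning nor independent yields a proper cyclic flat of its own, which by
      -- uniqueness is `F`.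
      lower : ∀ X → λrk (rank M) (r F) F X ≤ r X
      lower X with r X ℕₚ.<? rank M | r X ℕₚ.<? ∣ X ∣
      ... | no rX≮k  | _         = ℕₚ.≤-trans (ℕₚ.m⊓n≤m _ _) (ℕₚ.≮⇒≥ rX≮k)
      ... | yes _    | no rX≮X   = ℕₚ.≤-trans (rk-bounded (Λ (rank M) (r F) F) X) (ℕₚ.≮⇒≥ rX≮X)
      ... | yes rX<k | yes rX<X with G , pG , le ← degenerate⇒properCyclicFlat X rX<k rX<X
        with refl ← properCyclicFlat-unique pF pG
        = ℕₚ.≤-trans (ℕₚ.m⊓n≤n _ _) (ℕₚ.≤-trans (ℕₚ.+-monoʳ-≤ ∣ X ∩ ∁ G ∣ (ℕₚ.m⊓n≤m (r G) _))
            (ℕₚ.≤-trans (ℕₚ.≤-reflexive (ℕₚ.+-comm ∣ X ∩ ∁ G ∣ (r G))) le))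

-- Tutte polynomials through corank and nullity

_≟ˢ_ : ∀ {n} (X Y : Subset n) → Dec (X ≡ Y)
_≟ˢ_ = ≡-dec _≟ᵇ_

module _ {n} (k ρ : ℕ) (F : Subset n) where

  private
    corank nullity : Subset n → ℕ
    corank S  = k ∸ λrk k ρ F S
    nullity S = ∣ S ∣ ∸ λrk k ρ F S

  -- Either `S` spans, or it is independent, or its rank is `ρ + ∣ S ∩ ∁ F ∣`. In the last case its
  -- point falls short of that of `F` by `∣ S ∩ ∁ F ∣` in corank and by `∣ F ∩ ∁ S ∣` in nullity.
  Λ-corank-nullity : ∀ S → corank S ≡ 0 ⊎ nullity S ≡ 0 ⊎
    (corank S + ∣ S ∩ ∁ F ∣ ≡ k ∸ ρ × nullity S + ∣ F ∩ ∁ S ∣ ≡ ∣ F ∣ ∸ ρ)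
  Λ-corank-nullity S with ℕₚ.≤-total k (preΛ ρ F S)
  ... | inj₁ k≤ = inj₁ (trans (cong (k ∸_) (ℕₚ.m≤n⇒m⊓n≡m k≤)) (ℕₚ.n∸n≡0 k))
  ... | inj₂ ≤k with ℕₚ.≤-total ∣ S ∩ F ∣ ρ
  ...   | inj₁ i≤ρ = inj₂ (inj₁ (ℕₚ.m≤n⇒m∸n≡0 (ℕₚ.≤-reflexive (begin
    ∣ S ∣                       ≡⟨ ∣∩∣+∣∩∁∣ S F ⟨
    ∣ S ∩ F ∣ + ∣ S ∩ ∁ F ∣     ≡⟨ ℕₚ.+-comm ∣ S ∩ F ∣ _ ⟩
    ∣ S ∩ ∁ F ∣ + ∣ S ∩ F ∣     ≡⟨ cong (∣ S ∩ ∁ F ∣ +_) (ℕₚ.m≥n⇒m⊓n≡n i≤ρ) ⟨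
    preΛ ρ F S                  ≡⟨ ℕₚ.m≥n⇒m⊓n≡n ≤k ⟨
    λrk k ρ F S                 ∎))))
    where open ≡-Reasoning
  ...   | inj₂ ρ≤i = inj₂ (inj₂ (co , nu))
    where
    open ≡-Reasoning
    o = ∣ S ∩ ∁ F ∣
    r≡ : λrk k ρ F S ≡ ρ + o
    r≡ = trans (ℕₚ.m≥n⇒m⊓n≡n ≤k) (trans (cong (o +_) (ℕₚ.m≤n⇒m⊓n≡m ρ≤i)) (ℕₚ.+-comm o ρ))
    o≤ : o ≤ k ∸ ρ
    o≤ = ℕₚ.m+n≤o⇒m≤o∸n o (subst (_≤ k)
      (trans (ℕₚ.m≥n⇒m⊓n≡n ≤k) (cong (o +_) (ℕₚ.m≤n⇒m⊓n≡m ρ≤i))) (ℕₚ.m⊓n≤m k _))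
    co : corank S + o ≡ k ∸ ρ
    co = begin
      corank S + o        ≡⟨ cong (λ t → k ∸ t + o) r≡ ⟩
      k ∸ (ρ + o) + o     ≡⟨ cong (_+ o) (ℕₚ.∸-+-assoc k ρ o) ⟨
      k ∸ ρ ∸ o + o       ≡⟨ ℕₚ.m∸n+n≡m o≤ ⟩
      k ∸ ρ               ∎
    nu : nullity S + ∣ F ∩ ∁ S ∣ ≡ ∣ F ∣ ∸ ρ
    nu = begin
      nullity S + ∣ F ∩ ∁ S ∣                         ≡⟨ cong (λ t → ∣ S ∣ ∸ t + ∣ F ∩ ∁ S ∣) r≡ ⟩
      ∣ S ∣ ∸ (ρ + o) + ∣ F ∩ ∁ S ∣                   ≡⟨ cong (λ t → t ∸ (ρ + o) + ∣ F ∩ ∁ S ∣) (trans (sym (∣∩∣+∣∩∁∣ S F)) (ℕₚ.+-comm _ o)) ⟩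
      o + ∣ S ∩ F ∣ ∸ (ρ + o) + ∣ F ∩ ∁ S ∣           ≡⟨ cong (λ t → o + ∣ S ∩ F ∣ ∸ t + ∣ F ∩ ∁ S ∣) (ℕₚ.+-comm ρ o) ⟩
      o + ∣ S ∩ F ∣ ∸ (o + ρ) + ∣ F ∩ ∁ S ∣           ≡⟨ cong (_+ ∣ F ∩ ∁ S ∣) (ℕₚ.[m+n]∸[m+o]≡n∸o o _ ρ) ⟩
      ∣ S ∩ F ∣ ∸ ρ + ∣ F ∩ ∁ S ∣                     ≡⟨ ℕₚ.+-∸-comm _ ρ≤i ⟨
      ∣ S ∩ F ∣ + ∣ F ∩ ∁ S ∣ ∸ ρ                     ≡⟨ cong (λ X → ∣ X ∣ + ∣ F ∩ ∁ S ∣ ∸ ρ) (∩-comm S F) ⟩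
      ∣ F ∩ S ∣ + ∣ F ∩ ∁ S ∣ ∸ ρ                     ≡⟨ cong (_∸ ρ) (∣∩∣+∣∩∁∣ F S) ⟩
      ∣ F ∣ ∸ ρ                                       ∎

  -- Equality of the sums would make both shortfalls zero, so `S` and `F` would contain each other.
  Λ-off-flat : ∀ {S} → S ≢ F → corank S ≡ 0 ⊎ nullity S ≡ 0 ⊎
    (corank S ≤ k ∸ ρ × nullity S ≤ ∣ F ∣ ∸ ρ × corank S + nullity S < (k ∸ ρ) + (∣ F ∣ ∸ ρ))
  Λ-off-flat {S} S≢F with Λ-corank-nullity S
  ... | inj₁ eq = inj₁ eq
  ... | inj₂ (inj₁ eq) = inj₂ (inj₁ eq)
  ... | inj₂ (inj₂ (co , nu)) = inj₂ (inj₂ (co≤ , nu≤ , ℕₚ.≤∧≢⇒< (ℕₚ.+-mono-≤ co≤ nu≤) strict))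
    where
    co≤ : corank S ≤ k ∸ ρ
    co≤ = ℕₚ.m+n≤o⇒m≤o _ (ℕₚ.≤-reflexive co)
    nu≤ : nullity S ≤ ∣ F ∣ ∸ ρ
    nu≤ = ℕₚ.m+n≤o⇒m≤o _ (ℕₚ.≤-reflexive nu)
    ⊆-of : ∀ {X Y : Subset n} → ∣ X ∩ ∁ Y ∣ ≡ 0 → X ⊆ Y
    ⊆-of {X} {Y} eq {x} x∈X = decidable-stable (x ∈? Y) λ x∉Y →
      x∉Y (∣∣≡0⇒⊆ {A = X ∩ ∁ Y} eq (x∈p∩q⁺ (x∈X , x∉p⇒x∈∁p x∉Y)))
    strict : corank S + nullity S ≢ (k ∸ ρ) + (∣ F ∣ ∸ ρ)
    strict eq = S≢F (⊆-antisym (⊆-of o≡0) (⊆-of d≡0))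
      where
      od≡0 : ∣ S ∩ ∁ F ∣ + ∣ F ∩ ∁ S ∣ ≡ 0
      od≡0 = sym (ℕₚ.+-cancelˡ-≡ (corank S + nullity S) 0 _ (begin
        corank S + nullity S + 0                                              ≡⟨ ℕₚ.+-identityʳ _ ⟩
        corank S + nullity S                                                  ≡⟨ eq ⟩
        (k ∸ ρ) + (∣ F ∣ ∸ ρ)                                                 ≡⟨ cong₂ _+_ co nu ⟨
        (corank S + ∣ S ∩ ∁ F ∣) + (nullity S + ∣ F ∩ ∁ S ∣)                  ≡⟨ ℕ-semigroup.interchange (corank S) _ _ _ ⟩
        (corank S + nullity S) + (∣ S ∩ ∁ F ∣ + ∣ F ∩ ∁ S ∣)                  ∎))
        where
        open ≡-Reasoning
      o≡0 = ℕₚ.m+n≡0⇒m≡0 ∣ S ∩ ∁ F ∣ od≡0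
      d≡0 = ℕₚ.m+n≡0⇒n≡0 ∣ S ∩ ∁ F ∣ od≡0

  λrk-flat : ρ ≤ k → ρ ≤ ∣ F ∣ → λrk k ρ F F ≡ ρ
  λrk-flat ρ≤k ρ≤F = begin
    k ⊓ (∣ F ∩ ∁ F ∣ + ρ ⊓ ∣ F ∩ F ∣)  ≡⟨ cong (λ t → k ⊓ (t + ρ ⊓ ∣ F ∩ F ∣)) (trans (cong ∣_∣ (∩-inverseʳ F)) (∣⊥∣≡0 n)) ⟩
    k ⊓ (ρ ⊓ ∣ F ∩ F ∣)                ≡⟨ cong (λ X → k ⊓ (ρ ⊓ ∣ X ∣)) (∩-idem F) ⟩
    k ⊓ (ρ ⊓ ∣ F ∣)                    ≡⟨ cong (k ⊓_) (ℕₚ.m≤n⇒m⊓n≡m ρ≤F) ⟩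
    k ⊓ ρ                              ≡⟨ ℕₚ.m≥n⇒m⊓n≡n ρ≤k ⟩
    ρ                                  ∎
    where open ≡-Reasoning

uniform-corank-nullity : ∀ {n} k (S : Subset n) → k ∸ λrk k k ⊤ S ≡ 0 ⊎ ∣ S ∣ ∸ λrk k k ⊤ S ≡ 0
uniform-corank-nullity k S with Λ-corank-nullity k k ⊤ S
... | inj₁ eq              = inj₁ eq
... | inj₂ (inj₁ eq)       = inj₂ eq
... | inj₂ (inj₂ (co , _)) = inj₁ (ℕₚ.m+n≡0⇒m≡0 _ (trans co (ℕₚ.n∸n≡0 k)))

-- E k M φ is the Tutte polynomial with (x - 1)^u (y - 1)^v replaced by φ u v.
E : ∀ {n} → ℕ → Matroid n → (ℕ → ℕ → ℤ) → ℤ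
E {n} k M φ = ∑ (λ S → φ (k ∸ rk M S) (∣ S ∣ ∸ rk M S)) (allSubsets n)

tutte-E : ∀ {n k} (M : Matroid n) → rank M ≡ k → ∀ i j → tutte M i j ≡ E k M (λ u v → mono u v i j)
tutte-E {n} M refl i j = sumP-∑ _ (allSubsets n) i j

E-cong : ∀ {n} k {M N : Matroid n} → (∀ X → rk M X ≡ rk N X) → ∀ φ → E k M φ ≡ E k N φ
E-cong {n} k eq φ = ∑-cong (λ S → cong (λ t → φ (k ∸ t) (∣ S ∣ ∸ t)) (eq S)) (allSubsets n)

E-≅ : ∀ {n} k (M N : Matroid n) → M ≅ N → ∀ φ → E k M φ ≡ E k N φ
E-≅ {n} k M N (σ , eq) φ = trans
  (∑-cong (λ S → sym (cong₂ (λ s t → φ (k ∸ t) (s ∸ t)) (∣permImage∣ σ S) (eq S))) (allSubsets n))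
  (∑-allSubsets-permImage σ (λ S → φ (k ∸ rk N S) (∣ S ∣ ∸ rk N S)))

-- The point (u, v) compared with the boundary point of its diagonal.
D : ℕ → ℕ → (ℕ → ℕ → ℤ) → ℤ
D u v φ = φ u v ℤ.- φ (u ∸ v) (v ∸ u)

D-boundary : ∀ {u v} φ → u ≡ 0 ⊎ v ≡ 0 → D u v φ ≡ 0ℤ
D-boundary {v = v} φ (inj₁ refl) = ℤₚ.i≡j⇒i-j≡0 (cong (λ t → φ t v) (sym (ℕₚ.0∸n≡0 v)))
D-boundary {u = u} φ (inj₂ refl) = ℤₚ.i≡j⇒i-j≡0 (cong (φ u) (sym (ℕₚ.0∸n≡0 u)))

E-D : ∀ {n} → ℕ → Matroid n → (ℕ → ℕ → ℤ) → ℤ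
E-D {n} k M φ = ∑ (λ S → D (k ∸ rk M S) (∣ S ∣ ∸ rk M S) φ) (allSubsets n)

∸-∸-cancel : ∀ {r s k} → r ≤ k → r ≤ s → (k ∸ r) ∸ (s ∸ r) ≡ k ∸ s
∸-∸-cancel {r} r≤k r≤s = trans (sym (ℕₚ.[m+n]∸[m+o]≡n∸o r _ _)) (cong₂ _∸_ (ℕₚ.m+[n∸m]≡n r≤k) (ℕₚ.m+[n∸m]≡n r≤s))

-- One of the two arguments of `φ` is always zero: this is the boundary point on the diagonal of
-- `S`.
E-boundary : ℕ → ℕ → (ℕ → ℕ → ℤ) → ℤ
E-boundary n k φ = ∑ (λ S → φ (k ∸ ∣ S ∣) (∣ S ∣ ∸ k)) (allSubsets n)

-- corank - nullity = k - |S| depends on S only, so the boundary part of E is the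
-- same for all matroids of rank k.
E-split : ∀ {n k} (M : Matroid n) → rank M ≡ k → ∀ φ → E k M φ ≡ E-D k M φ ℤ.+ E-boundary n k φ
E-split {n} {k} M refl φ = trans (∑-cong term (allSubsets n))
  (∑-+ (λ S → D (k ∸ rk M S) (∣ S ∣ ∸ rk M S) φ) (λ S → φ (k ∸ ∣ S ∣) (∣ S ∣ ∸ k)) (allSubsets n))
  where
  term : ∀ S → φ (k ∸ rk M S) (∣ S ∣ ∸ rk M S) ≡
         D (k ∸ rk M S) (∣ S ∣ ∸ rk M S) φ ℤ.+ φ (k ∸ ∣ S ∣) (∣ S ∣ ∸ k)
  term S = trans (sym (//-rightDividesˡ _ (φ (k ∸ rk M S) (∣ S ∣ ∸ rk M S))))
    (cong (λ z → D (k ∸ rk M S) (∣ S ∣ ∸ rk M S) φ ℤ.+ z)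
      (cong₂ φ (∸-∸-cancel (rk-mono M ⊆⊤) (rk-bounded M S)) (∸-∸-cancel (rk-bounded M S) (rk-mono M ⊆⊤))))

-- Existence and uniqueness

module Existence {n k s : ℕ} (k≤n : k ≤ n) (N : Fin s → Matroid n)
  (complete : ∀ (L : Matroid n) → Cuspidal L → rank L ≡ k → ∃ λ i → L ≅ N i) where

  open Span (λ i → E k (N i))

  E-cuspidal : ∀ L → Cuspidal L → rank L ≡ k → InSpan (E k L)
  E-cuspidal L cuspidal rank≡k with i , L≅Nᵢ ← complete L cuspidal rank≡k =
    span-cong (E-≅ k L (N i) L≅Nᵢ) (span-basis i)

  E-Λ : ∀ ρ F → ρ ≤ ∣ F ∣ → k ≤ ∣ ∁ F ∣ + ρ → InSpan (E k (Λ k ρ F))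
  E-Λ ρ F ρ≤F k≤ = E-cuspidal (Λ k ρ F) (Λ-Schubert , Λ-ElementarySplit {k = k} {ρ = ρ} {F = F}) (rank-Λ k ρ F ρ≤F k≤)

  private
    k≤⊤ : k ≤ ∣ ⊤ {n} ∣
    k≤⊤ = subst (k ≤_) (sym (∣⊤∣≡n n)) k≤n
    k≤∁⊤+k : k ≤ ∣ ∁ (⊤ {n}) ∣ + k
    k≤∁⊤+k = ℕₚ.m≤n+m k _

  -- In U_{k,n} every set lies on the boundary, so its `E-D` part vanishes.
  boundary-inSpan : InSpan (E-boundary n k)
  boundary-inSpan = span-cong eq (E-Λ k (⊤ {n}) k≤⊤ k≤∁⊤+k)
    where
    eq : ∀ φ → E-boundary n k φ ≡ E k (Λ k k (⊤ {n})) φ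
    eq φ = sym (trans (E-split (Λ k k (⊤ {n})) (rank-Λ k k (⊤ {n}) k≤⊤ k≤∁⊤+k) φ)
      (trans (cong (λ z → z ℤ.+ E-boundary n k φ)
         (∑-zero (λ S → D-boundary φ (uniform-corank-nullity k S)) (allSubsets n)))
       (ℤₚ.+-identityˡ _)))

  -- Strong induction on `u + v`, with fuel `w`. A suitable Λ has its flat at (u, v), and every
  -- other set contributes zero or a point of smaller sum, which is subtracted.
  D-inSpan : ∀ w u v → u + v < w → u ≤ k → v ≤ n ∸ k → InSpan (D u v)
  D-inSpan (suc w) u v (s≤s u+v≤w) u≤k v≤n-k
    -- Rank `k ∸ u` gives the flat corank `u`, and `v` further elements give it nullity `v`. The
    -- bounds on `u` and `v` make such a set fit into the ground set.
    with F , ∣F∣ ← ∃-∣∣≡ {k ∸ u + v} n (ℕₚ.≤-trans (ℕₚ.+-mono-≤ (ℕₚ.m∸n≤m k u) v≤n-k) (ℕₚ.≤-reflexive (ℕₚ.m+[n∸m]≡n k≤n)))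
    = span-cong eq (span-minus E-D-inSpan (span-∑ others-inSpan (allSubsets n)))
    where
    τ = k ∸ u
    τ≤k : τ ≤ k
    τ≤k = ℕₚ.m∸n≤m k u
    τ≤F : τ ≤ ∣ F ∣
    τ≤F = subst (τ ≤_) (sym ∣F∣) (ℕₚ.m≤m+n τ v)
    a≡u : k ∸ τ ≡ u
    a≡u = ℕₚ.m∸[m∸n]≡n u≤k
    b≡v : ∣ F ∣ ∸ τ ≡ v
    b≡v = trans (cong (_∸ τ) ∣F∣) (ℕₚ.m+n∸m≡n τ v)
    L = Λ k τ F

    k≤ : k ≤ ∣ ∁ F ∣ + τ
    k≤ = begin
      k             ≡⟨ ℕₚ.m+[n∸m]≡n u≤k ⟨
      u + τ         ≤⟨ ℕₚ.+-monoˡ-≤ τ (ℕₚ.m+n≤o⇒m≤o∸n u u+F≤n) ⟩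
      n ∸ ∣ F ∣ + τ ≡⟨ cong (_+ τ) (∣∁p∣≡n∸∣p∣ F) ⟨
      ∣ ∁ F ∣ + τ   ∎
      where
      open ℕₚ.≤-Reasoning
      u+F≤n : u + ∣ F ∣ ≤ n
      u+F≤n = begin
        u + ∣ F ∣     ≡⟨ cong (u +_) ∣F∣ ⟩
        u + (τ + v)   ≡⟨ ℕₚ.+-assoc u τ v ⟨
        u + τ + v     ≤⟨ ℕₚ.+-mono-≤ (ℕₚ.≤-reflexive (ℕₚ.m+[n∸m]≡n u≤k)) v≤n-k ⟩
        k + (n ∸ k)   ≡⟨ ℕₚ.m+[n∸m]≡n k≤n ⟩
        n             ∎

    E-D-inSpan : InSpan (E-D k L)
    E-D-inSpan = span-cong (λ φ → sym (trans (cong (λ z → z ℤ.- E-boundary n k φ) (E-split L (rank-Λ k τ F τ≤F k≤) φ))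
                                              (//-rightDividesʳ _ (E-D k L φ))))
                   (span-minus (E-Λ τ F τ≤F k≤) boundary-inSpan)

    -- `others` is zero at `F`, so that both sums run over the same list and their difference has a
    -- single nonzero term.
    term others : Subset n → (ℕ → ℕ → ℤ) → ℤ
    term S = D (k ∸ rk L S) (∣ S ∣ ∸ rk L S)
    others S φ with S ≟ˢ F
    ... | yes _ = 0ℤ
    ... | no  _ = term S φ

    others-inSpan : ∀ S → InSpan (others S)
    others-inSpan S with S ≟ˢ F
    ... | yes _ = span-0 (λ _ → refl)
    ... | no S≢F with Λ-off-flat k τ F S≢F
    ...   | inj₁ eq = span-0 (λ φ → D-boundary φ (inj₁ eq))
    ...   | inj₂ (inj₁ eq) = span-0 (λ φ → D-boundary φ (inj₂ eq))
    ...   | inj₂ (inj₂ (u′≤ , v′≤ , u′+v′<)) = D-inSpan w _ _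
      (ℕₚ.<-≤-trans u′+v′< (ℕₚ.≤-trans (ℕₚ.≤-reflexive (cong₂ _+_ a≡u b≡v)) u+v≤w))
      (ℕₚ.m∸n≤m k (rk L S))
      (ℕₚ.≤-trans v′≤ (subst (_≤ n ∸ k) (sym b≡v) v≤n-k))

    eq : ∀ φ → D u v φ ≡ E-D k L φ ℤ.- ∑ (λ S → others S φ) (allSubsets n)
    eq φ = sym (begin
      E-D k L φ ℤ.- ∑ (λ S → others S φ) (allSubsets n)   ≡⟨ ∑-minus (λ S → term S φ) (λ S → others S φ) (allSubsets n) ⟨
      ∑ (λ S → term S φ ℤ.- others S φ) (allSubsets n)    ≡⟨ ∑-allSubsets-single F off ⟩
      term F φ ℤ.- others F φ                             ≡⟨ on ⟩
      term F φ
        ≡⟨ cong₂ (λ u v → D u v φ) (trans (cong (k ∸_) rF) a≡u) (trans (cong (∣ F ∣ ∸_) rF) b≡v) ⟩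
      D u v φ                                             ∎)
      where
      open ≡-Reasoning
      rF : rk L F ≡ τ
      rF = λrk-flat k τ F τ≤k τ≤F
      off : ∀ S → S ≢ F → term S φ ℤ.- others S φ ≡ 0ℤ
      off S S≢F with S ≟ˢ F
      ... | yes S≡F = ⊥-elim (S≢F S≡F)
      ... | no _    = ℤₚ.i≡j⇒i-j≡0 {term S φ} refl
      on : term F φ ℤ.- others F φ ≡ term F φ
      on with F ≟ˢ F
      ... | yes _   = ℤₚ.+-identityʳ _
      ... | no F≢F  = ⊥-elim (F≢F refl)

  -- The complement of `S` can add at most its size to the rank, so `k ≤ rk M S + ∣ ∁ S ∣`.
  nullity≤ : ∀ (M : Matroid n) → rank M ≡ k → ∀ S → ∣ S ∣ ∸ rk M S ≤ n ∸ k
  nullity≤ M refl S = ℕₚ.m≤n+o⇒m∸n≤o ∣ S ∣ (rk M S) (begin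
    ∣ S ∣                        ≤⟨ ℕₚ.m+n≤o⇒m≤o∸n ∣ S ∣ S+k≤ ⟩
    n + rk M S ∸ k               ≡⟨ cong (_∸ k) (ℕₚ.+-comm n (rk M S)) ⟩
    rk M S + n ∸ k               ≡⟨ ℕₚ.+-∸-assoc (rk M S) k≤n ⟩
    rk M S + (n ∸ k)             ∎)
    where
    open ℕₚ.≤-Reasoning
    S+k≤ : ∣ S ∣ + k ≤ n + rk M S
    S+k≤ = begin
      ∣ S ∣ + rank M                        ≤⟨ ℕₚ.+-monoʳ-≤ ∣ S ∣ (begin
        rank M                              ≡⟨ cong (rk M) (p∪∁p≡⊤ S) ⟨
        rk M (S ∪ ∁ S)                      ≤⟨ ℕₚ.m≤m+n _ _ ⟩
        _                                   ≤⟨ rk-submod M S (∁ S) ⟩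
        rk M S + rk M (∁ S)                 ≤⟨ ℕₚ.+-monoʳ-≤ (rk M S) (rk-bounded M (∁ S)) ⟩
        rk M S + ∣ ∁ S ∣                    ∎) ⟩
      ∣ S ∣ + (rk M S + ∣ ∁ S ∣)            ≡⟨ cong (λ t → ∣ S ∣ + (rk M S + t)) (∣∁p∣≡n∸∣p∣ S) ⟩
      ∣ S ∣ + (rk M S + (n ∸ ∣ S ∣))        ≡⟨ ℕ-semigroup.x∙yz≈xz∙y ∣ S ∣ (rk M S) _ ⟩
      ∣ S ∣ + (n ∸ ∣ S ∣) + rk M S          ≡⟨ cong (_+ rk M S) (ℕₚ.m+[n∸m]≡n (∣p∣≤n S)) ⟩
      n + rk M S                            ∎

  E-inSpan : ∀ M → rank M ≡ k → InSpan (E k M)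
  E-inSpan M rank≡k = span-cong (E-split M rank≡k) (span-+
    (span-∑ (λ S → D-inSpan _ _ _ ℕₚ.≤-refl (ℕₚ.m∸n≤m k (rk M S)) (nullity≤ M rank≡k S)) (allSubsets n))
    boundary-inSpan)

-- Normal forms and leading coefficients

record Form {n} (k : ℕ) (M : Matroid n) : Set where
  constructor form
  field
    flat     : Subset n
    flatRank : ℕ
    -- The uniform matroid keeps one fixed presentation. In the other case both leading exponents
    -- are positive, and together they determine `flatRank` and `∣ flat ∣`.
    kind     : (flat ≡ ⊤ × flatRank ≡ k) ⊎ (flatRank < k × flatRank < ∣ flat ∣)
    rk≗      : ∀ X → rk M X ≡ λrk k flatRank flat X

cuspidal-form : ∀ {n k} (M : Matroid n) → rank M ≡ k → Cuspidal M → Form k M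
cuspidal-form M refl cuspidal with F , ρ , kind , rk≗ ← cuspidal⇒Λ M cuspidal = form F ρ kind rk≗

-- A permutation carrying `F` to `G` preserves the sizes of the two parts of `X`, on which alone the
-- rank depends.
form-≅ : ∀ {n k ρ} {F G : Subset n} (M N : Matroid n) →
         (∀ X → rk M X ≡ λrk k ρ F X) → (∀ X → rk N X ≡ λrk k ρ G X) → ∣ F ∣ ≡ ∣ G ∣ → M ≅ N
form-≅ {k = k} {ρ} {F} {G} M N rkM rkN F≡G with σ , refl ← ∣∣≡⇒~ F G F≡G = σ , λ X →
  trans (rkN (permImage σ X)) (trans (cong (k ⊓_) (cong₂ (λ a b → a + ρ ⊓ b)
    (trans (cong (λ Y → ∣ permImage σ X ∩ Y ∣) (permImage-∁ σ F)) (trans (cong ∣_∣ (permImage-∩ σ X (∁ F))) (∣permImage∣ σ (X ∩ ∁ F))))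
    (trans (cong ∣_∣ (permImage-∩ σ X F)) (∣permImage∣ σ (X ∩ F)))))
   (sym (rkM X)))

mono-vanish : ∀ u v i j → u < i ⊎ v < j → mono u v i j ≡ 0ℤ
mono-vanish u v i j (inj₁ u<i) = mono-x-high v j u<i
mono-vanish u v i j (inj₂ v<j) = mono-y-high u i v<j

+≤+⇒≡⊎<⊎< : ∀ {a b c d} → a + b ≤ c + d → (a ≡ c × b ≡ d) ⊎ a < c ⊎ b < d
+≤+⇒≡⊎<⊎< {a} {b} {c} {d} le with a ℕₚ.<? c | b ℕₚ.<? d
... | yes a<c | _       = inj₂ (inj₁ a<c)
... | no _    | yes b<d = inj₂ (inj₂ b<d)
... | no a≮c  | no b≮d  = inj₁
  ( ℕₚ.≤-antisym (ℕₚ.+-cancelʳ-≤ b _ _ (ℕₚ.≤-trans le (ℕₚ.+-monoʳ-≤ c (ℕₚ.≮⇒≥ b≮d)))) (ℕₚ.≮⇒≥ a≮c)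
  , ℕₚ.≤-antisym (ℕₚ.+-cancelˡ-≤ a _ _ (ℕₚ.≤-trans le (ℕₚ.+-monoˡ-≤ d (ℕₚ.≮⇒≥ a≮c)))) (ℕₚ.≮⇒≥ b≮d))

+<+⇒<⊎< : ∀ {a b c d} → a + b < c + d → a < c ⊎ b < d
+<+⇒<⊎< {a} {b} {c} {d} lt with +≤+⇒≡⊎<⊎< {a} {b} {c} {d} (ℕₚ.<⇒≤ lt)
... | inj₁ (refl , refl) = ⊥-elim (ℕₚ.<-irrefl refl lt)
... | inj₂ lt′           = lt′

module _ {n k : ℕ} where

  private
    coefficient : Subset n → ℕ → ℕ → ℕ → Subset n → ℤ
    coefficient F ρ i j S = mono (k ∸ λrk k ρ F S) (∣ S ∣ ∸ λrk k ρ F S) i j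

  tutte-form : ∀ {M : Matroid n} → rank M ≡ k → (f : Form k M) → ∀ i j →
               tutte M i j ≡ ∑ (coefficient (Form.flat f) (Form.flatRank f) i j) (allSubsets n)
  tutte-form {M} rank≡k (form F ρ _ rk≗) i j = trans (tutte-E M rank≡k i j)
    (E-cong k {M} {Λ k ρ F} rk≗ (λ u v → mono u v i j))

  -- Positive exponents kill the boundary points; any other point has a sum below `i + j`, so it is
  -- too small in some coordinate.
  coefficient-off-flat : ∀ F ρ {i j S} → 0 < i → 0 < j → (k ∸ ρ) + (∣ F ∣ ∸ ρ) ≤ i + j → S ≢ F →
                         coefficient F ρ i j S ≡ 0ℤ
  coefficient-off-flat F ρ {i} {j} {S} 0<i 0<j ≤i+j S≢F = mono-vanish u v i j (below (Λ-off-flat k ρ F S≢F))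
    where
    u = k ∸ λrk k ρ F S
    v = ∣ S ∣ ∸ λrk k ρ F S
    below : (u ≡ 0 ⊎ v ≡ 0 ⊎ (u ≤ k ∸ ρ × v ≤ ∣ F ∣ ∸ ρ × u + v < (k ∸ ρ) + (∣ F ∣ ∸ ρ))) → u < i ⊎ v < j
    below (inj₁ u≡0)                 = inj₁ (subst (_< i) (sym u≡0) 0<i)
    below (inj₂ (inj₁ v≡0))          = inj₂ (subst (_< j) (sym v≡0) 0<j)
    below (inj₂ (inj₂ (_ , _ , lt))) = +<+⇒<⊎< {u} {v} (ℕₚ.<-≤-trans lt ≤i+j)

  coefficient-flat : ∀ F ρ {i j} → ρ ≤ k → ρ ≤ ∣ F ∣ → coefficient F ρ i j F ≡ mono (k ∸ ρ) (∣ F ∣ ∸ ρ) i j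
  coefficient-flat F ρ {i} {j} ρ≤k ρ≤F = cong (λ r → mono (k ∸ r) (∣ F ∣ ∸ r) i j) (λrk-flat k ρ F ρ≤k ρ≤F)

  -- For U_{k,n} the coefficient of x^k works if k > 0; for k = 0 it is that of y^n.
  weight leadX leadY : ∀ {M : Matroid n} → Form k M → ℕ
  weight (form F ρ (inj₁ _) _) = 0
  weight (form F ρ (inj₂ _) _) = (k ∸ ρ) + (∣ F ∣ ∸ ρ)
  leadX (form F ρ (inj₁ _) _) = k
  leadX (form F ρ (inj₂ _) _) = k ∸ ρ
  leadY (form F ρ (inj₁ _) _) = uniformY k
    where
    uniformY : ℕ → ℕ
    uniformY zero    = n
    uniformY (suc _) = 0
  leadY (form F ρ (inj₂ _) _) = ∣ F ∣ ∸ ρ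

  weight< : ∀ {M : Matroid n} (f : Form k M) → weight f < suc (k + n)
  weight< (form F ρ (inj₁ _) _) = s≤s z≤n
  weight< (form F ρ (inj₂ _) _) = s≤s (ℕₚ.+-mono-≤ (ℕₚ.m∸n≤m k ρ) (ℕₚ.≤-trans (ℕₚ.m∸n≤m ∣ F ∣ ρ) (∣p∣≤n F)))

  -- Two uniform forms are isomorphic, and a nonuniform one has positive weight, hence is not below
  -- a uniform one. A uniform `N` has only boundary points, which miss positive exponents. If
  -- neither is uniform, only the flat of `N` could contribute, and it would have to sit at the same
  -- point as that of `M`.
  lower-vanish : ∀ {M N : Matroid n} → rank N ≡ k → (f : Form k M) (g : Form k N) → ¬ (N ≅ M) →
                 weight g ≤ weight f → tutte N (leadX f) (leadY f) ≡ 0ℤ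
  lower-vanish {M} {N} _ (form _ _ (inj₁ (refl , refl)) rkM) (form _ _ (inj₁ (refl , refl)) rkN) N≇M _ =
    ⊥-elim (N≇M (form-≅ N M rkN rkM refl))
  lower-vanish _ (form _ _ (inj₁ _) _) (form _ ρ (inj₂ (ρ<k , _)) _) _ w≤0 =
    ⊥-elim (ℕₚ.<⇒≱ (ℕₚ.m<n⇒0<n∸m ρ<k) (ℕₚ.m+n≤o⇒m≤o (k ∸ ρ) w≤0))
  lower-vanish rank≡k (form F ρ (inj₂ (ρ<k , ρ<F)) _) g@(form _ _ (inj₁ (refl , refl)) _) _ _ =
    trans (tutte-form rank≡k g _ _) (∑-zero (λ S → mono-vanish (k ∸ λrk k k ⊤ S) (∣ S ∣ ∸ λrk k k ⊤ S) (k ∸ ρ) (∣ F ∣ ∸ ρ)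
      ([ (λ eq → inj₁ (subst (_< k ∸ ρ) (sym eq) (ℕₚ.m<n⇒0<n∸m ρ<k)))
       , (λ eq → inj₂ (subst (_< ∣ F ∣ ∸ ρ) (sym eq) (ℕₚ.m<n⇒0<n∸m ρ<F))) ]′ (uniform-corank-nullity k S))) (allSubsets n))
  lower-vanish {M} {N} rank≡k (form F ρ (inj₂ (ρ<k , ρ<F)) rkM) g@(form G τ (inj₂ (τ<k , τ<G)) rkN) N≇M w≤ =
    trans (tutte-form rank≡k g _ _) (trans
      (∑-allSubsets-single G (λ S → coefficient-off-flat G τ (ℕₚ.m<n⇒0<n∸m ρ<k) (ℕₚ.m<n⇒0<n∸m ρ<F) w≤))
      (trans (coefficient-flat G τ (ℕₚ.<⇒≤ τ<k) (ℕₚ.<⇒≤ τ<G)) (mono-vanish (k ∸ τ) (∣ G ∣ ∸ τ) _ _ (distinct (+≤+⇒≡⊎<⊎< w≤)))))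
    where
    distinct : ((k ∸ τ ≡ k ∸ ρ × ∣ G ∣ ∸ τ ≡ ∣ F ∣ ∸ ρ) ⊎ k ∸ τ < k ∸ ρ ⊎ ∣ G ∣ ∸ τ < ∣ F ∣ ∸ ρ) →
               k ∸ τ < k ∸ ρ ⊎ ∣ G ∣ ∸ τ < ∣ F ∣ ∸ ρ
    distinct (inj₂ lt) = lt
    distinct (inj₁ (a≡ , b≡)) with refl ← ℕₚ.∸-cancelˡ-≡ (ℕₚ.<⇒≤ τ<k) (ℕₚ.<⇒≤ ρ<k) a≡ =
      ⊥-elim (N≇M (form-≅ N M rkN rkM (ℕₚ.∸-cancelʳ-≡ (ℕₚ.<⇒≤ τ<G) (ℕₚ.<⇒≤ ρ<F) b≡)))

  leading-nonuniform : ∀ {M : Matroid n} → rank M ≡ k → ∀ {F ρ} (lt : ρ < k × ρ < ∣ F ∣)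
                       (rk≗ : ∀ X → rk M X ≡ λrk k ρ F X) → tutte M (k ∸ ρ) (∣ F ∣ ∸ ρ) ≡ 1ℤ
  leading-nonuniform {M} rank≡k {F} {ρ} lt@(ρ<k , ρ<F) rk≗ =
    trans (tutte-form {M} rank≡k (form F ρ (inj₂ lt) rk≗) _ _) (trans
      (∑-allSubsets-single F (λ S → coefficient-off-flat F ρ (ℕₚ.m<n⇒0<n∸m ρ<k) (ℕₚ.m<n⇒0<n∸m ρ<F) ℕₚ.≤-refl))
      (trans (coefficient-flat F ρ (ℕₚ.<⇒≤ ρ<k) (ℕₚ.<⇒≤ ρ<F)) (mono-lead (k ∸ ρ) (∣ F ∣ ∸ ρ))))

leading : ∀ {n k} {M : Matroid n} → rank M ≡ k → (f : Form k M) → tutte M (leadX f) (leadY f) ≡ 1ℤ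
leading {M = M} rank≡k (form F ρ (inj₂ lt) rk≗) = leading-nonuniform {M = M} rank≡k lt rk≗
leading {n} {zero} rank≡k f@(form _ _ (inj₁ (refl , refl)) rk≗) =
  trans (tutte-form rank≡k f 0 n) (trans
    (∑-allSubsets-single (⊤ {n}) (λ S S≢⊤ → mono-vanish 0 ∣ S ∣ 0 n (inj₂ (ℕₚ.≤∧≢⇒< (∣p∣≤n S) (S≢⊤ ∘ ∣p∣≡n⇒p≡⊤)))))
    (trans (cong (λ v → mono 0 v 0 n) (∣⊤∣≡n n)) (mono-lead 0 n)))
-- The top power of x needs rank zero, and in a uniform matroid of positive rank only the empty set
-- has it.
leading {n} {suc k} rank≡k f@(form _ _ (inj₁ (refl , refl)) rk≗) =
  trans (tutte-form rank≡k f (suc k) 0) (trans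
    (∑-allSubsets-single (⊥ {n}) (λ S S≢⊥ → mono-vanish _ (∣ S ∣ ∸ λrk (suc k) (suc k) ⊤ S) (suc k) 0
      (inj₁ (ℕₚ.∸-monoʳ-< (rank>0 S S≢⊥) (ℕₚ.m⊓n≤m (suc k) _)))))
    (trans (cong₂ (λ r v → mono (suc k ∸ r) (v ∸ r) (suc k) 0) rank⊥ (∣⊥∣≡0 n)) (mono-lead (suc k) 0)))
  where
  rank⊥ : λrk (suc k) (suc k) (⊤ {n}) ⊥ ≡ 0
  rank⊥ = ℕₚ.n≤0⇒n≡0 (ℕₚ.≤-trans (rk-bounded (Λ (suc k) (suc k) (⊤ {n})) ⊥) (ℕₚ.≤-reflexive (∣⊥∣≡0 n)))
  rank>0 : ∀ (S : Subset n) → S ≢ ⊥ → 0 < λrk (suc k) (suc k) ⊤ S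
  rank>0 S S≢⊥ = ℕₚ.⊓-pres-m< {0} {suc k} (s≤s z≤n) (ℕₚ.<-≤-trans
    (ℕₚ.⊓-pres-m< {0} {suc k} (s≤s z≤n) (subst (λ X → 0 < ∣ X ∣) (sym (∩-identityʳ S))
      (ℕₚ.≤∧≢⇒< z≤n λ 0≡ → S≢⊥ (⊆-antisym (∣∣≡0⇒⊆ (sym 0≡)) (⊆-min S)))))
    (ℕₚ.m≤n+m _ _))

theoremC : (k n : ℕ) → k ≤ n → (s : ℕ) → (N : Fin s → Matroid n) →
    (∀ i → Cuspidal (N i) × rank (N i) ≡ k) →
    (∀ i j → i ≢ j → ¬ (N i ≅ N j)) →
    (∀ (L : Matroid n) → Cuspidal L → rank L ≡ k → Σ (Fin s) λ i → L ≅ N i) →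
    (M : Matroid n) → rank M ≡ k →
    Σ (Fin s → ℤ) λ c →
    (tutte M ≈P linComb c (λ i → tutte (N i))) ×
    (∀ (c′ : Fin s → ℤ) → tutte M ≈P linComb c′ (λ i → tutte (N i)) → ∀ i → c′ i ≡ c i)
theoremC k n k≤n s N cuspidal distinct complete M rank≡k = c , existence , uniqueness
  where
  open Existence k≤n N complete
  c : Fin s → ℤ
  c = proj₁ (E-inSpan M rank≡k)
  T : Fin s → Poly
  T i = tutte (N i)
  rankN : ∀ i → rank (N i) ≡ k
  rankN i = proj₂ (cuspidal i)
  existence : tutte M ≈P linComb c T
  existence i j = begin
    tutte M i j                                              ≡⟨ tutte-E M rank≡k i j ⟩
    -- Here `φ` extracts the coefficient of x^i y^j; `c` does not depend on `φ`, so it serves all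
    -- `i` and `j`.
    E k M (λ u v → mono u v i j)                             ≡⟨ proj₂ (E-inSpan M rank≡k) (λ u v → mono u v i j) ⟩
    ∑ (λ l → c l ℤ.* E k (N l) (λ u v → mono u v i j)) (allFin s)
      ≡⟨ ∑-cong (λ l → cong (c l ℤ.*_) (tutte-E (N l) (rankN l) i j)) (allFin s) ⟨
    ∑ (λ l → c l ℤ.* T l i j) (allFin s)                     ≡⟨ linComb-∑ c T i j ⟨
    linComb c T i j                                          ∎
    where open ≡-Reasoning
  f : ∀ i → Form k (N i)
  f i = cuspidal-form (N i) (rankN i) (proj₁ (cuspidal i))
  uniqueness : ∀ c′ → tutte M ≈P linComb c′ T → ∀ i → c′ i ≡ c i
  uniqueness c′ eq i = ℤₚ.i-j≡0⇒i≡j (c′ i) (c i)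
    (triangular⇒independent T (weight ∘ f) (leadX ∘ f) (leadY ∘ f) (suc (k + n)) (weight< ∘ f)
      (λ i → leading (rankN i) (f i))
      (λ i j j≢i → lower-vanish (rankN j) (f i) (f j) (distinct j i j≢i))
      (λ l → c′ l ℤ.- c l)
      (linComb-minus c′ c T (λ i j → trans (sym (eq i j)) (existence i j))) i)
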